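{- Let $p\ge 3$ and $n\ge 0$ be integers, let $D$ be a $p$-angulation of an $(n+3)$-gon, and let $(m_{i,j})$ be the frieze of type $\Lambda_p$ and width $n$ corresponding to $D$. Let $v_0,\dots,v_{n+2}$ be the vertices of the associated Farey path, with indices considered modulo $n+3$. Then for all $i\in\mathbb{Z}$ and all $j$ with $-2\le j-i\le n+1$, $$m_{i,j}=d(v_{i-1},v_{j+1}),$$ where $d$ denotes the Farey distance.
   Context: A frieze of width $n$ is an array of real numbers $(m_{i,j})$, indexed by $i\in\mathbb{Z}$ and $j$ with $-2\le j-i\le n+1$, such that $m_{i,i-2}=m_{i,i+n+1}=0$, $m_{i,i-1}=m_{i,i+n}=1$, the remaining entries are positive, and the unimodular rule $m_{i,i+r}m_{i+1,i+r+1}-m_{i+1,i+r}m_{i,i+r+1}=1$ holds for all $i\in\mathbb{Z}$ and $-1\le r\le n$. The row $(m_{i,i})_{i\in\mathbb{Z}}$ is called the quiddity row; it determines the frieze via $m_{i,i+r}=m_{i,i}m_{i+1,i+r}-m_{i+2,i+r}$. A $p$-angulation $D$ of a convex regular polygon $P$ is a set of non-intersecting diagonals partitioning $P$ into a finite collection of $p$-gons. Let $P$ have $n+3$ vertices, labelled $0,1,\dots,n+2$ in cyclic order. Let $q_\alpha$ be the number of $p$-gons of $D$ incident with the vertex $\alpha$, and let $\lambda_p=2\cos(\pi/p)$. The frieze of type $\Lambda_p$ corresponding to $D$ is the frieze of width $n$ with $m_{i,i}=\lambda_p q_{i\bmod (n+3)}$ for all $i\in\mathbb{Z}$ (it is known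 that such a frieze exists and is unique). Define Möbius transformations $\xi_\alpha(z)=q_\alpha\lambda_p-\frac1z$ for $0\le\alpha\le n+2$, and the vertices of the associated Farey path by $v_0=\infty$ and $v_\alpha=\xi_0\xi_1\cdots\xi_{\alpha-1}(\infty)$ (composition of maps) for $1\le\alpha\le n+2$. Each vertex is written as a fraction $v_\alpha=\frac{a_\alpha}{b_\alpha}$ with numerator $a_\alpha=m_{0,\alpha-1}$ and denominator $b_\alpha=m_{1,\alpha-1}$ for $0\le\alpha\le n+2$ (with $\frac10=\infty$). The Farey distance of two vertices is $d(v_i,v_j)=|a_ib_j-a_jb_i|$. -}

module Defs where

open import Algebra.Bundles using (CommutativeRing)
import Algebra.Definitions.RawSemiring as RawSemiringDefinitions
import Algebra.Properties.Ring as RingProperties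
open import Data.Fin.Base as Fin using (Fin; toℕ; fromℕ<)
import Data.Fin.Properties as Fin
open import Data.Fin.Subset using (Subset; inside; outside; ∣_∣; _∈_)
open import Data.Fin.Subset.Properties using (_∈?_)
open import Data.Integer.Base as ℤ using (ℤ; +_; -[1+_]; 0ℤ; 1ℤ; -1ℤ)
open import Data.Integer.DivMod using (_%ℕ_; n%ℕd<d)
import Data.Integer.Properties as ℤ
import Data.Integer.Solver as ℤSolver
open import Data.List.Base as List using (List; []; _∷_; foldr; take; allFin; tabulate)
open import Data.Nat.Base as ℕ using (ℕ; zero; suc; NonZero; _⊔_; _!)
import Data.Nat.DivMod as ℕ
import Data.Nat.Properties as ℕ
open import Data.Product.Base using (_×_; _,_; proj₁; proj₂; ∃-syntax)
open import Data.Rational.Base as ℚ using (ℚ; 0ℚ; 1ℚ; ½)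
import Data.Rational.Properties as ℚ
import Data.Rational.Solver as ℚSolver
import Data.Rational.Unnormalised.Base as ℚᵘ
import Data.Rational.Unnormalised.Properties as ℚᵘP
open import Data.Sum.Base using (_⊎_; inj₁; inj₂)
import Data.Vec.Base as Vec
open import Function.Base using (_∘_)
open import Level using (0ℓ)
open import Relation.Binary.Core using (Rel)
open import Relation.Binary.Definitions using (Decidable; Symmetric)
open import Relation.Binary.PropositionalEquality
  using (_≡_; _≢_; refl; sym; trans; cong; cong₂; subst; module ≡-Reasoning)
import Relation.Binary.Reasoning.Setoid as ≈-Reasoning
open import Relation.Nullary using (¬_; Dec; yes; no; ¬?; _×-dec_; _⊎-dec_; _→-dec_)
open import Relation.Nullary.Decidable using (map′)

module _ where
  open import Data.Rational.Base using (_+_; _*_; _-_; -_; _<_; _≤_) renaming (∣_∣ to abs)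
  open ℚSolver.+-*-Solver

  open RawSemiringDefinitions ℚ.+-*-rawSemiring public using () renaming (_^_ to _^ℚ_)

  private
    rearrange-+ : ∀ a b c d → (a + b) - (c + d) ≡ (a - c) + (b - d)
    rearrange-+ = solve 4 (λ a b c d → (a :+ b) :- (c :+ d) := (a :- c) :+ (b :- d)) refl

    rearrange-neg : ∀ a b → - a - - b ≡ - (a - b)
    rearrange-neg = solve 2 (λ a b → :- a :- :- b := :- (a :- b)) refl

    rearrange-* : ∀ a b c d → a * b - c * d ≡ b * (a - c) + c * (b - d)
    rearrange-* = solve 4 (λ a b c d → a :* b :- c :* d := b :* (a :- c) :+ c :* (b :- d)) refl

    cancel-minus : ∀ p q → p ≡ (p - q) + q
    cancel-minus = solve 2 (λ p q → p := (p :- q) :+ q) refl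

    cancel-plus : ∀ p q → p + q - q ≡ p
    cancel-plus = solve 2 (λ p q → p :+ q :- q := p) refl

    flip-minus : ∀ p q → q - p ≡ - (p - q)
    flip-minus = solve 2 (λ p q → q :- p := :- (p :- q)) refl

    abs-minus : ∀ p q → abs (p - q) ≡ abs (q - p)
    abs-minus p q = trans (cong abs (flip-minus q p)) (ℚ.∣-p∣≡∣p∣ (q - p))

    0<½* : ∀ {ε} → 0ℚ < ε → 0ℚ < ½ * ε
    0<½* {ε} 0<ε = ℚ.positive⁻¹ (½ * ε) {{ℚ.pos*pos⇒pos ½ ε {{ℚ.positive 0<ε}}}}

    ½+½ : ∀ ε → ½ * ε + ½ * ε ≡ ε
    ½+½ = solve 1 (λ ε → con ½ :* ε :+ con ½ :* ε := ε) refl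

    mono-* : ∀ {p q r s} → 0ℚ ≤ p → 0ℚ ≤ s → p ≤ q → r ≤ s → p * r ≤ q * s
    mono-* {p} {q} {r} {s} 0≤p 0≤s p≤q r≤s = ℚ.≤-trans
      (ℚ.*-monoˡ-≤-nonNeg p {{ℚ.nonNegative 0≤p}} r≤s)
      (ℚ.*-monoʳ-≤-nonNeg s {{ℚ.nonNegative 0≤s}} p≤q)

    0≤* : ∀ {p q} → 0ℚ ≤ p → 0ℚ ≤ q → 0ℚ ≤ p * q
    0≤* {p} {q} 0≤p 0≤q = ℚ.nonNegative⁻¹ (p * q)
      {{ℚ.nonNeg*nonNeg⇒nonNeg p {{ℚ.nonNegative 0≤p}} q {{ℚ.nonNegative 0≤q}}}}

  -- f i is eventually smaller than any ε, where U N i reads "i is beyond stage N".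
  Small : {I : Set} → (ℕ → I → Set) → (I → ℚ) → Set
  Small U f = ∀ ε → 0ℚ < ε → ∃[ N ] ∀ i → U N i → abs (f i) < ε

  module SmallFamilies {I : Set} (U : ℕ → I → Set)
                       (down : ∀ {M N} → M ℕ.≤ N → ∀ {i} → U N i → U M i) where

    private variable
      f g h : I → ℚ

    small-dominated : (∃[ N ] ∀ i → U N i → abs (g i) ≤ abs (f i)) → Small U f → Small U g
    small-dominated (N , g≤f) f→0 ε 0<ε with f→0 ε 0<ε
    ... | M , f<ε = N ⊔ M , λ i u → ℚ.≤-<-trans
      (g≤f i (down (ℕ.m≤m⊔n N M) u)) (f<ε i (down (ℕ.m≤n⊔m N M) u))

    small-cong : (∀ i → g i ≡ f i) → Small U f → Small U g
    small-cong g≗f = small-dominated (0 , λ i _ → ℚ.≤-reflexive (cong abs (g≗f i)))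

    small-zero : (∀ i → f i ≡ 0ℚ) → Small U f
    small-zero {f} f≗0 ε 0<ε = 0 , λ i _ → subst (λ q → abs q < ε) (sym (f≗0 i)) 0<ε

    small-neg : Small U f → Small U (λ i → - f i)
    small-neg {f} = small-dominated (0 , λ i _ → ℚ.≤-reflexive (ℚ.∣-p∣≡∣p∣ (f i)))

    small-+ : Small U f → Small U g → Small U (λ i → f i + g i)
    small-+ {f} {g} f→0 g→0 ε 0<ε with f→0 (½ * ε) (0<½* 0<ε) | g→0 (½ * ε) (0<½* 0<ε)
    ... | M , f< | N , g< = M ⊔ N , λ i u → ℚ.≤-<-trans (ℚ.∣p+q∣≤∣p∣+∣q∣ (f i) (g i))
      (subst (abs (f i) + abs (g i) <_) (½+½ ε)
        (ℚ.+-mono-< (f< i (down (ℕ.m≤m⊔n M N) u)) (g< i (down (ℕ.m≤n⊔m M N) u))))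

    small-scale : ∀ c → Small U f → Small U (λ i → c * f i)
    small-scale {f} c f→0 = small-dominated (0 , λ i _ → bound i) (scale-pos (abs c + 1ℚ) f→0)
      where
      0<c+1 : 0ℚ < abs c + 1ℚ
      0<c+1 = ℚ.+-mono-≤-< (ℚ.0≤∣p∣ c) (ℚ.positive⁻¹ 1ℚ)
      instance
        pos : ℚ.Positive (abs c + 1ℚ)
        pos = ℚ.positive 0<c+1
      scale-pos : ∀ b .{{_ : ℚ.Positive b}} → Small U f → Small U (λ i → b * f i)
      scale-pos b f→0 ε 0<ε with f→0 (b⁻¹ * ε) (ℚ.positive⁻¹ (b⁻¹ * ε)
          {{ℚ.pos*pos⇒pos b⁻¹ {{ℚ.1/pos⇒pos b}} ε {{ℚ.positive 0<ε}}}})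
        where b⁻¹ = ℚ.1/_ b {{ℚ.pos⇒nonZero b}}
      ... | N , f< = N , λ i u → begin-strict
        abs (b * f i)       ≡⟨ ℚ.∣p*q∣≡∣p∣*∣q∣ b (f i) ⟩
        abs b * abs (f i)   ≡⟨ cong (_* abs (f i)) (ℚ.0≤p⇒∣p∣≡p (ℚ.<⇒≤ (ℚ.positive⁻¹ b))) ⟩
        b * abs (f i)       <⟨ ℚ.*-monoʳ-<-pos b (f< i u) ⟩
        b * (b⁻¹ * ε)       ≡⟨ ℚ.*-assoc b b⁻¹ ε ⟨
        b * b⁻¹ * ε         ≡⟨ cong (_* ε) (ℚ.*-inverseʳ b {{ℚ.pos⇒nonZero b}}) ⟩
        1ℚ * ε              ≡⟨ ℚ.*-identityˡ ε ⟩
        ε                   ∎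
        where
        open ℚ.≤-Reasoning
        b⁻¹ = ℚ.1/_ b {{ℚ.pos⇒nonZero b}}
      bound : ∀ i → abs (c * f i) ≤ abs ((abs c + 1ℚ) * f i)
      bound i = begin
        abs (c * f i)                  ≡⟨ ℚ.∣p*q∣≡∣p∣*∣q∣ c (f i) ⟩
        abs c * abs (f i)              ≤⟨ ℚ.*-monoʳ-≤-nonNeg (abs (f i)) {{ℚ.∣-∣-nonNeg (f i)}} c≤ ⟩
        (abs c + 1ℚ) * abs (f i)       ≡⟨ cong (_* abs (f i)) (ℚ.0≤p⇒∣p∣≡p (ℚ.<⇒≤ 0<c+1)) ⟨
        abs (abs c + 1ℚ) * abs (f i)   ≡⟨ ℚ.∣p*q∣≡∣p∣*∣q∣ (abs c + 1ℚ) (f i) ⟨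
        abs ((abs c + 1ℚ) * f i)       ∎
        where
        open ℚ.≤-Reasoning
        c≤ : abs c ≤ abs c + 1ℚ
        c≤ = subst (_≤ abs c + 1ℚ) (ℚ.+-identityʳ (abs c)) (ℚ.+-monoʳ-≤ (abs c) (ℚ.nonNegative⁻¹ 1ℚ))

    small-* : (∃[ B ] ∃[ N ] ∀ i → U N i → abs (g i) ≤ B) → Small U f → Small U (λ i → g i * f i)
    small-* {g} {f} (B , N , g≤B) f→0 = small-dominated (N , bound) (small-scale B f→0)
      where
      bound : ∀ i → U N i → abs (g i * f i) ≤ abs (B * f i)
      bound i u = begin
        abs (g i * f i)       ≡⟨ ℚ.∣p*q∣≡∣p∣*∣q∣ (g i) (f i) ⟩
        abs (g i) * abs (f i) ≤⟨ ℚ.*-monoʳ-≤-nonNeg (abs (f i)) {{ℚ.∣-∣-nonNeg (f i)}} (g≤B i u) ⟩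
        B * abs (f i)         ≡⟨ cong (_* abs (f i)) (ℚ.0≤p⇒∣p∣≡p (ℚ.≤-trans (ℚ.0≤∣p∣ (g i)) (g≤B i u))) ⟨
        abs B * abs (f i)     ≡⟨ ℚ.∣p*q∣≡∣p∣*∣q∣ B (f i) ⟨
        abs (B * f i)         ∎
        where open ℚ.≤-Reasoning

  Null : (ℕ → ℚ) → Set
  Null x = ∀ ε → 0ℚ < ε → ∃[ N ] ∀ n → N ℕ.≤ n → abs (x n) < ε

  Cauchy : (ℕ → ℚ) → Set
  Cauchy x = ∀ ε → 0ℚ < ε → ∃[ N ] ∀ m n → N ℕ.≤ m → N ℕ.≤ n → abs (x m - x n) < ε

  module NullSeq = SmallFamilies {ℕ} ℕ._≤_ (λ M≤N N≤n → ℕ.≤-trans M≤N N≤n)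

  private
    Both : ℕ → ℕ × ℕ → Set
    Both N (m , n) = N ℕ.≤ m × N ℕ.≤ n

    module Pairs = SmallFamilies Both
      (λ M≤N (N≤m , N≤n) → ℕ.≤-trans M≤N N≤m , ℕ.≤-trans M≤N N≤n)

    difference : (ℕ → ℚ) → ℕ × ℕ → ℚ
    difference x (m , n) = x m - x n

    toSmall : ∀ x → Cauchy x → Small Both (difference x)
    toSmall x cx ε 0<ε with cx ε 0<ε
    ... | N , x< = N , λ (m , n) (N≤m , N≤n) → x< m n N≤m N≤n

    fromSmall : ∀ x → Small Both (difference x) → Cauchy x
    fromSmall x sx ε 0<ε with sx ε 0<ε
    ... | N , x< = N , λ m n N≤m N≤n → x< (m , n) (N≤m , N≤n)

  abstract
    cauchy-const : ∀ q → Cauchy (λ _ → q)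
    cauchy-const q = fromSmall (λ _ → q) (Pairs.small-zero (λ _ → ℚ.+-inverseʳ q))

  abstract
    cauchy-+ : ∀ x y → Cauchy x → Cauchy y → Cauchy (λ n → x n + y n)
    cauchy-+ x y cx cy = fromSmall (λ n → x n + y n) (Pairs.small-cong
      (λ (m , n) → rearrange-+ (x m) (y m) (x n) (y n))
      (Pairs.small-+ (toSmall x cx) (toSmall y cy)))

  abstract
    cauchy-neg : ∀ x → Cauchy x → Cauchy (λ n → - x n)
    cauchy-neg x cx = fromSmall (λ n → - x n) (Pairs.small-cong
      (λ (m , n) → rearrange-neg (x m) (x n))
      (Pairs.small-neg (toSmall x cx)))

  cauchy-bounded : ∀ x → Cauchy x → ∃[ B ] ∃[ N ] ∀ n → N ℕ.≤ n → abs (x n) ≤ B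
  cauchy-bounded x cx with cx 1ℚ (ℚ.positive⁻¹ 1ℚ)
  ... | N , x< = 1ℚ + abs (x N) , N , λ n N≤n → begin
    abs (x n)                      ≡⟨ cong abs (cancel-minus (x n) (x N)) ⟩
    abs ((x n - x N) + x N)        ≤⟨ ℚ.∣p+q∣≤∣p∣+∣q∣ (x n - x N) (x N) ⟩
    abs (x n - x N) + abs (x N)    ≤⟨ ℚ.+-monoˡ-≤ (abs (x N)) (ℚ.<⇒≤ (x< n N N≤n ℕ.≤-refl)) ⟩
    1ℚ + abs (x N)                 ∎
    where open ℚ.≤-Reasoning

  abstract
    cauchy-* : ∀ x y → Cauchy x → Cauchy y → Cauchy (λ n → x n * y n)
    cauchy-* x y cx cy = fromSmall (λ n → x n * y n) (Pairs.small-cong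
      (λ (m , n) → rearrange-* (x m) (y m) (x n) (y n))
      (Pairs.small-+
        (Pairs.small-* y-bounded (toSmall x cx))
        (Pairs.small-* x-bounded (toSmall y cy))))
      where
      y-bounded : ∃[ B ] ∃[ N ] ∀ i → Both N i → abs (y (proj₁ i)) ≤ B
      y-bounded = let B , N , y≤B = cauchy-bounded y cy in B , N , λ (m , _) (N≤m , _) → y≤B m N≤m
      x-bounded : ∃[ B ] ∃[ N ] ∀ i → Both N i → abs (x (proj₂ i)) ≤ B
      x-bounded = let B , N , x≤B = cauchy-bounded x cx in B , N , λ (_ , n) (_ , N≤n) → x≤B n N≤n

  private
    reverse-triangle : ∀ p q → abs p - abs q ≤ abs (p - q)
    reverse-triangle p q = begin
      abs p - abs q                 ≡⟨ cong (λ r → abs r - abs q) (cancel-minus p q) ⟩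
      abs ((p - q) + q) - abs q     ≤⟨ ℚ.+-monoˡ-≤ (- abs q) (ℚ.∣p+q∣≤∣p∣+∣q∣ (p - q) q) ⟩
      abs (p - q) + abs q - abs q   ≡⟨ cancel-plus (abs (p - q)) (abs q) ⟩
      abs (p - q)                   ∎
      where open ℚ.≤-Reasoning

  ∣∣p∣-∣q∣∣≤∣p-q∣ : ∀ p q → abs (abs p - abs q) ≤ abs (p - q)
  ∣∣p∣-∣q∣∣≤∣p-q∣ p q with ℚ.∣p∣≡p∨∣p∣≡-p (abs p - abs q)
  ... | inj₁ eq = subst (_≤ abs (p - q)) (sym eq) (reverse-triangle p q)
  ... | inj₂ eq = subst (_≤ abs (p - q)) (sym eq) (subst (_≤ abs (p - q))
      (flip-minus (abs p) (abs q))
      (subst (abs q - abs p ≤_) (abs-minus q p) (reverse-triangle q p)))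

  abstract
    cauchy-abs : ∀ x → Cauchy x → Cauchy (λ n → abs (x n))
    cauchy-abs x cx = fromSmall (λ n → abs (x n)) (Pairs.small-dominated
      (0 , λ (m , n) _ → ∣∣p∣-∣q∣∣≤∣p-q∣ (x m) (x n)) (toSmall x cx))

  -- a 0 - a 1 + a 2 - ⋯ ± a (n - 1)
  alternating : (ℕ → ℚ) → ℕ → ℚ
  alternating a zero    = 0ℚ
  alternating a (suc n) = a 0 - alternating (a ∘ suc) n

  recip : (n : ℕ) .{{_ : NonZero n}} → ℚ
  recip n = + 1 ℚ./ n

  private
    alternating-bounds : ∀ a n → (∀ k → 0ℚ ≤ a k) → (∀ k → a (suc k) ≤ a k) →
                         0ℚ ≤ alternating a n × alternating a n ≤ a 0
    alternating-bounds a zero    0≤a a↓ = ℚ.≤-refl , 0≤a 0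
    alternating-bounds a (suc n) 0≤a a↓ = lower , upper
      where
      IH = alternating-bounds (a ∘ suc) n (0≤a ∘ suc) (a↓ ∘ suc)
      S = alternating (a ∘ suc) n
      lower : 0ℚ ≤ a 0 - S
      lower = subst (_≤ a 0 - S) (ℚ.+-inverseʳ S) (ℚ.+-monoˡ-≤ (- S) (ℚ.≤-trans (proj₂ IH) (a↓ 0)))
      upper : a 0 - S ≤ a 0
      upper = subst (a 0 - S ≤_) (ℚ.+-identityʳ (a 0)) (ℚ.+-monoʳ-≤ (a 0) (ℚ.neg-antimono-≤ (proj₁ IH)))

    cancel-first : ∀ a s t → (a - s) - (a - t) ≡ - (s - t)
    cancel-first = solve 3 (λ a s t → (a :- s) :- (a :- t) := :- (s :- t)) refl

    minus-zero : ∀ s → s - 0ℚ ≡ s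
    minus-zero = solve 1 (λ s → s :- con 0ℚ := s) refl

    alternating-split : ∀ a k j → abs (alternating a (k ℕ.+ j) - alternating a k)
                                ≡ abs (alternating (a ∘ (k ℕ.+_)) j)
    alternating-split a zero    j = cong abs (minus-zero (alternating a j))
    alternating-split a (suc k) j = trans (cong abs (cancel-first (a 0) _ _))
      (trans (ℚ.∣-p∣≡∣p∣ _) (alternating-split (a ∘ suc) k j))

    alternating-tail : ∀ a k n → k ℕ.≤ n → (∀ i → 0ℚ ≤ a i) → (∀ i → k ℕ.≤ i → a (suc i) ≤ a i) →
                       abs (alternating a n - alternating a k) ≤ a k
    alternating-tail a k n k≤n 0≤a a↓ = begin
      abs (alternating a n - alternating a k)
        ≡⟨ cong (λ m → abs (alternating a m - alternating a k)) (ℕ.m+[n∸m]≡n k≤n) ⟨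
      abs (alternating a (k ℕ.+ j) - alternating a k)   ≡⟨ alternating-split a k j ⟩
      abs (alternating b j)                             ≡⟨ ℚ.0≤p⇒∣p∣≡p (proj₁ bounds) ⟩
      alternating b j                                   ≤⟨ proj₂ bounds ⟩
      a (k ℕ.+ 0)                                       ≡⟨ cong a (ℕ.+-identityʳ k) ⟩
      a k                                               ∎
      where
      open ℚ.≤-Reasoning
      j = n ℕ.∸ k
      b = a ∘ (k ℕ.+_)
      bounds = alternating-bounds b j (λ i → 0≤a (k ℕ.+ i))
        (λ i → subst (λ m → a m ≤ b i) (sym (ℕ.+-suc k i)) (a↓ (k ℕ.+ i) (ℕ.m≤m+n k i)))

    cauchy-alternating : ∀ (a : ℕ → ℕ → ℚ) K → (∀ k → Cauchy (a k)) →
                         Cauchy (λ n → alternating (λ k → a k n) K)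
    cauchy-alternating a zero    ca = cauchy-const 0ℚ
    cauchy-alternating a (suc K) ca = cauchy-+ (a 0) (λ n → - rest n) (ca 0)
      (cauchy-neg rest (cauchy-alternating (a ∘ suc) K (ca ∘ suc)))
      where
      rest : ℕ → ℚ
      rest n = alternating (λ k → a (suc k) n) K

    fromℕ : ℕ → ℚ
    fromℕ n = + n ℚ./ 1

    toℚᵘ-fromℕ : ∀ n → ℚ.toℚᵘ (fromℕ n) ℚᵘ.≃ ℚᵘ.mkℚᵘ (+ n) 0
    toℚᵘ-fromℕ n = ℚ.toℚᵘ-fromℚᵘ (ℚᵘ.mkℚᵘ (+ n) 0)

    fromℕ-mono : ∀ {m n} → m ℕ.≤ n → fromℕ m ≤ fromℕ n
    fromℕ-mono {m} {n} m≤n = ℚ.toℚᵘ-cancel-≤ (begin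
      ℚ.toℚᵘ (fromℕ m)    ≃⟨ toℚᵘ-fromℕ m ⟩
      ℚᵘ.mkℚᵘ (+ m) 0     ≤⟨ ℚᵘ.*≤* (ℤ.*-monoʳ-≤-nonNeg (+ 1) (ℤ.+≤+ m≤n)) ⟩
      ℚᵘ.mkℚᵘ (+ n) 0     ≃⟨ toℚᵘ-fromℕ n ⟨
      ℚ.toℚᵘ (fromℕ n)    ∎)
      where open ℚᵘP.≤-Reasoning

    fromℕ-mono-< : ∀ {m n} → m ℕ.< n → fromℕ m < fromℕ n
    fromℕ-mono-< {m} {n} m<n = ℚ.toℚᵘ-cancel-< (begin-strict
      ℚ.toℚᵘ (fromℕ m)    ≃⟨ toℚᵘ-fromℕ m ⟩
      ℚᵘ.mkℚᵘ (+ m) 0     <⟨ ℚᵘ.*<* (ℤ.*-monoʳ-<-pos (+ 1) (ℤ.+<+ m<n)) ⟩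
      ℚᵘ.mkℚᵘ (+ n) 0     ≃⟨ toℚᵘ-fromℕ n ⟨
      ℚ.toℚᵘ (fromℕ n)    ∎)
      where open ℚᵘP.≤-Reasoning

    fromℕ-recip : ∀ n .{{_ : NonZero n}} → fromℕ n * recip n ≡ 1ℚ
    fromℕ-recip n@(suc k) = ℚ.toℚᵘ-injective (begin
      ℚ.toℚᵘ (fromℕ n * recip n)                  ≈⟨ ℚ.toℚᵘ-homo-* (fromℕ n) (recip n) ⟩
      ℚ.toℚᵘ (fromℕ n) ℚᵘ.* ℚ.toℚᵘ (recip n)      ≈⟨ ℚᵘP.*-cong (toℚᵘ-fromℕ n) (ℚ.toℚᵘ-fromℚᵘ (ℚᵘ.mkℚᵘ (+ 1) k)) ⟩
      ℚᵘ.mkℚᵘ (+ n) 0 ℚᵘ.* ℚᵘ.mkℚᵘ (+ 1) k        ≈⟨ ℚᵘ.*≡* (trans (ℤ.*-identityʳ (+ n ℤ.* + 1)) (trans (ℤ.*-identityʳ (+ n)) (sym (trans (ℤ.*-identityˡ (+ (1 ℕ.* n))) (cong +_ (ℕ.*-identityˡ n)))))) ⟩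
      ℚᵘ.1ℚᵘ                                      ∎)
      where open ≈-Reasoning ℚᵘP.≃-setoid

    fromℕ-* : ∀ m n → fromℕ (m ℕ.* n) ≡ fromℕ m * fromℕ n
    fromℕ-* m n = ℚ.toℚᵘ-injective (begin
      ℚ.toℚᵘ (fromℕ (m ℕ.* n))                  ≈⟨ toℚᵘ-fromℕ (m ℕ.* n) ⟩
      ℚᵘ.mkℚᵘ (+ (m ℕ.* n)) 0                   ≈⟨ ℚᵘ.*≡* (cong (ℤ._* + 1) (ℤ.pos-* m n)) ⟩
      ℚᵘ.mkℚᵘ (+ m) 0 ℚᵘ.* ℚᵘ.mkℚᵘ (+ n) 0      ≈⟨ ℚᵘP.*-cong (toℚᵘ-fromℕ m) (toℚᵘ-fromℕ n) ⟨
      ℚ.toℚᵘ (fromℕ m) ℚᵘ.* ℚ.toℚᵘ (fromℕ n)    ≈⟨ ℚ.toℚᵘ-homo-* (fromℕ m) (fromℕ n) ⟨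
      ℚ.toℚᵘ (fromℕ m * fromℕ n)                ∎)
      where open ≈-Reasoning ℚᵘP.≃-setoid

    0≤recip : ∀ n .{{_ : NonZero n}} → 0ℚ ≤ recip n
    0≤recip n = ℚ.<⇒≤ (ℚ.positive⁻¹ (recip n) {{ℚ.normalize-pos 1 n}})

    fraction≤1 : ∀ {m} n .{{_ : NonZero n}} → m ℕ.≤ n → fromℕ m * recip n ≤ 1ℚ
    fraction≤1 {m} n m≤n = subst (fromℕ m * recip n ≤_) (fromℕ-recip n)
      (ℚ.*-monoʳ-≤-nonNeg (recip n) {{ℚ.nonNegative (0≤recip n)}} (fromℕ-mono m≤n))

    fraction<1 : ∀ {m} n .{{_ : NonZero n}} → m ℕ.< n → fromℕ m * recip n < 1ℚ
    fraction<1 {m} n m<n = subst (fromℕ m * recip n <_) (fromℕ-recip n)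
      (ℚ.*-monoˡ-<-pos (recip n) {{ℚ.normalize-pos 1 n}} (fromℕ-mono-< m<n))

    swap-factors : ∀ a b c → a * (b * c) ≡ (b * a) * c
    swap-factors = solve 3 (λ a b c → a :* (b :* c) := (b :* a) :* c) refl

    recip-antitone : ∀ m n .{{_ : NonZero m}} .{{_ : NonZero n}} → m ℕ.≤ n → recip n ≤ recip m
    recip-antitone m n m≤n = begin
      recip n                         ≡⟨ ℚ.*-identityʳ (recip n) ⟨
      recip n * 1ℚ                    ≡⟨ cong (recip n *_) (fromℕ-recip m) ⟨
      recip n * (fromℕ m * recip m)   ≡⟨ swap-factors (recip n) (fromℕ m) (recip m) ⟩
      fromℕ m * recip n * recip m     ≤⟨ ℚ.*-monoʳ-≤-nonNeg (recip m) {{ℚ.nonNegative (0≤recip m)}} (fraction≤1 n m≤n) ⟩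
      1ℚ * recip m                    ≡⟨ ℚ.*-identityˡ (recip m) ⟩
      recip m                         ∎
      where open ℚ.≤-Reasoning

    recip-*-rearrange : ∀ a b c d e → a * ((b * c) * (d * e)) ≡ ((b * d) * a) * (c * e)
    recip-*-rearrange = solve 5 (λ a b c d e → a :* ((b :* c) :* (d :* e)) := ((b :* d) :* a) :* (c :* e)) refl

    recip-* : ∀ m n .{{_ : NonZero m}} .{{_ : NonZero n}} →
              recip (m ℕ.* n) {{ℕ.m*n≢0 m n}} ≡ recip m * recip n
    recip-* m n = begin
      r                                                   ≡⟨ ℚ.*-identityʳ r ⟨
      r * (1ℚ * 1ℚ)                                       ≡⟨ cong (r *_) (cong₂ _*_ (fromℕ-recip m) (fromℕ-recip n)) ⟨
      r * ((fromℕ m * recip m) * (fromℕ n * recip n))     ≡⟨ recip-*-rearrange r (fromℕ m) (recip m) (fromℕ n) (recip n) ⟩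
      fromℕ m * fromℕ n * r * (recip m * recip n)         ≡⟨ cong (λ q → q * r * (recip m * recip n)) (fromℕ-* m n) ⟨
      fromℕ (m ℕ.* n) * r * (recip m * recip n)           ≡⟨ cong (_* (recip m * recip n)) (fromℕ-recip (m ℕ.* n) {{ℕ.m*n≢0 m n}}) ⟩
      1ℚ * (recip m * recip n)                            ≡⟨ ℚ.*-identityˡ (recip m * recip n) ⟩
      recip m * recip n                                   ∎
      where
      open ≡-Reasoning
      r = recip (m ℕ.* n) {{ℕ.m*n≢0 m n}}

    archimedean : ∀ q → ∃[ M ] q ≤ fromℕ M
    archimedean q@(ℚ.mkℚ (+ n) d c) = n , ℚ.toℚᵘ-cancel-≤ (begin
      ℚᵘ.mkℚᵘ (+ n) d     ≤⟨ ℚᵘ.*≤* (ℤ.*-monoˡ-≤-nonNeg (+ n) (ℤ.+≤+ (ℕ.s≤s ℕ.z≤n))) ⟩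
      ℚᵘ.mkℚᵘ (+ n) 0     ≃⟨ toℚᵘ-fromℕ n ⟨
      ℚ.toℚᵘ (fromℕ n)    ∎)
      where open ℚᵘP.≤-Reasoning
    archimedean q@(ℚ.mkℚ -[1+ n ] d c) = 0 , ℚ.nonPositive⁻¹ q

    recip-small : ∀ C ε → 0ℚ < ε → ∃[ N ] ∀ k → N ℕ.≤ k → C * recip (suc k) < ε
    recip-small C ε 0<ε = M , small
      where
      instance
        ε-pos : ℚ.Positive ε
        ε-pos = ℚ.positive 0<ε
      ε⁻¹ = ℚ.1/_ ε {{ℚ.pos⇒nonZero ε}}
      M = proj₁ (archimedean (ε⁻¹ * C))
      C≤ : C ≤ ε * fromℕ M
      C≤ = begin
        C               ≡⟨ ℚ.*-identityˡ C ⟨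
        1ℚ * C          ≡⟨ cong (_* C) (ℚ.*-inverseʳ ε {{ℚ.pos⇒nonZero ε}}) ⟨
        ε * ε⁻¹ * C     ≡⟨ ℚ.*-assoc ε ε⁻¹ C ⟩
        ε * (ε⁻¹ * C)   ≤⟨ ℚ.*-monoˡ-≤-nonNeg ε {{ℚ.nonNegative (ℚ.<⇒≤ 0<ε)}} (proj₂ (archimedean (ε⁻¹ * C))) ⟩
        ε * fromℕ M     ∎
        where open ℚ.≤-Reasoning
      small : ∀ k → M ℕ.≤ k → C * recip (suc k) < ε
      small k M≤k = begin-strict
        C * recip (suc k)                 ≤⟨ ℚ.*-monoʳ-≤-nonNeg (recip (suc k)) {{ℚ.nonNegative (0≤recip (suc k))}} C≤ ⟩
        ε * fromℕ M * recip (suc k)       ≡⟨ ℚ.*-assoc ε (fromℕ M) (recip (suc k)) ⟩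
        ε * (fromℕ M * recip (suc k))     <⟨ ℚ.*-monoʳ-<-pos ε (fraction<1 (suc k) (ℕ.s≤s M≤k)) ⟩
        ε * 1ℚ                            ≡⟨ ℚ.*-identityʳ ε ⟩
        ε                                 ∎
        where open ℚ.≤-Reasoning

    cauchy-from-tail : ∀ (x b : ℕ → ℚ) → (∀ k n → k ℕ.≤ n → abs (x n - x k) ≤ b k) →
                       (∀ ε → 0ℚ < ε → ∃[ k ] b k < ε) → Cauchy x
    cauchy-from-tail x b tail b→0 ε 0<ε = k , close
      where
      k = proj₁ (b→0 (½ * ε) (0<½* 0<ε))
      b<½ε = proj₂ (b→0 (½ * ε) (0<½* 0<ε))
      close : ∀ m n → k ℕ.≤ m → k ℕ.≤ n → abs (x m - x n) < ε
      close m n k≤m k≤n = begin-strict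
        abs (x m - x n)                       ≡⟨ cong abs (via (x m) (x k) (x n)) ⟩
        abs ((x m - x k) + (x k - x n))       ≤⟨ ℚ.∣p+q∣≤∣p∣+∣q∣ (x m - x k) (x k - x n) ⟩
        abs (x m - x k) + abs (x k - x n)     ≡⟨ cong (λ q → abs (x m - x k) + q) (abs-minus (x k) (x n)) ⟩
        abs (x m - x k) + abs (x n - x k)     <⟨ ℚ.+-mono-< (ℚ.≤-<-trans (tail k m k≤m) b<½ε) (ℚ.≤-<-trans (tail k n k≤n) b<½ε) ⟩
        ½ * ε + ½ * ε                         ≡⟨ ½+½ ε ⟩
        ε                                     ∎
        where
        open ℚ.≤-Reasoning
        via : ∀ p q r → p - r ≡ (p - q) + (q - r)
        via = solve 3 (λ p q r → p :- r := (p :- q) :+ (q :- r)) refl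

  leibnizSum : ℕ → ℚ
  leibnizSum = alternating (λ k → recip (suc (2 ℕ.* k)))

  abstract
    cauchy-leibnizSum : Cauchy leibnizSum
    cauchy-leibnizSum = cauchy-from-tail leibnizSum a
      (λ k n k≤n → alternating-tail a k n k≤n (λ i → 0≤recip (suc (2 ℕ.* i)))
        (λ i _ → recip-antitone (suc (2 ℕ.* i)) (suc (2 ℕ.* suc i)) (ℕ.s≤s (ℕ.*-monoʳ-≤ 2 (ℕ.n≤1+n i)))))
      (λ ε 0<ε → let N , small = recip-small 1ℚ ε 0<ε in N , ℚ.≤-<-trans
        (recip-antitone (suc N) (suc (2 ℕ.* N)) (ℕ.s≤s (ℕ.m≤m+n N (N ℕ.+ 0))))
        (subst (_< ε) (ℚ.*-identityˡ (recip (suc N))) (small N ℕ.≤-refl)))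
      where
      a : ℕ → ℚ
      a k = recip (suc (2 ℕ.* k))

  expTerm : ℚ → ℕ → ℚ
  expTerm x m = x ^ℚ m * recip (m !) {{m ℕ.!≢0}}

  cosTerm : ℚ → ℕ → ℚ
  cosTerm x k = expTerm x (2 ℕ.* k)

  cosSum : ℚ → ℕ → ℚ
  cosSum x = alternating (cosTerm x)

  private
    square-nonneg : ∀ x → 0ℚ ≤ x * x
    square-nonneg x with ℚ.≤-total 0ℚ x
    ... | inj₁ 0≤x = 0≤* 0≤x 0≤x
    ... | inj₂ x≤0 = subst (0ℚ ≤_) (neg-square x) (0≤* 0≤-x 0≤-x)
      where
      0≤-x : 0ℚ ≤ - x
      0≤-x = ℚ.neg-antimono-≤ x≤0
      neg-square : ∀ x → - x * - x ≡ x * x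
      neg-square = solve 1 (λ x → :- x :* :- x := x :* x) refl

    square-bound : ∀ x B → abs x ≤ B → x * x ≤ B * B
    square-bound x B x≤B = begin
      x * x           ≡⟨ ℚ.0≤p⇒∣p∣≡p (square-nonneg x) ⟨
      abs (x * x)     ≡⟨ ℚ.∣p*q∣≡∣p∣*∣q∣ x x ⟩
      abs x * abs x   ≤⟨ mono-* (ℚ.0≤∣p∣ x) (ℚ.≤-trans (ℚ.0≤∣p∣ x) x≤B) x≤B x≤B ⟩
      B * B           ∎
      where open ℚ.≤-Reasoning

    expTerm-rearrange : ∀ x y a b c → (x * (x * y)) * (a * (b * c)) ≡ (y * c) * (((x * x) * b) * a)
    expTerm-rearrange = solve 5 (λ x y a b c →
      (x :* (x :* y)) :* (a :* (b :* c)) := (y :* c) :* (((x :* x) :* b) :* a)) refl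

    expTerm-step : ∀ x m → expTerm x (suc (suc m)) ≡
                   expTerm x m * ((x * x * recip (suc m)) * recip (suc (suc m)))
    expTerm-step x m = trans
      (cong (x ^ℚ suc (suc m) *_) (trans
        (recip-* (suc (suc m)) (suc m !) {{_}} {{suc m ℕ.!≢0}})
        (cong (recip (suc (suc m)) *_) (recip-* (suc m) (m !) {{_}} {{m ℕ.!≢0}}))))
      (expTerm-rearrange x (x ^ℚ m) (recip (suc (suc m))) (recip (suc m)) (recip (m !) {{m ℕ.!≢0}}))

    cosTerm-step : ∀ x k → cosTerm x (suc k) ≡
                   cosTerm x k * ((x * x * recip (suc (2 ℕ.* k))) * recip (suc (suc (2 ℕ.* k))))
    cosTerm-step x k = trans (cong (expTerm x) (ℕ.*-suc 2 k)) (expTerm-step x (2 ℕ.* k))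

    0≤cosTerm : ∀ x k → 0ℚ ≤ cosTerm x k
    0≤cosTerm x zero    = 0≤* (ℚ.nonNegative⁻¹ 1ℚ) (0≤recip 1)
    0≤cosTerm x (suc k) = subst (0ℚ ≤_) (sym (cosTerm-step x k))
      (0≤* (0≤cosTerm x k)
        (0≤* (0≤* (square-nonneg x) (0≤recip (suc (2 ℕ.* k)))) (0≤recip (suc (suc (2 ℕ.* k))))))

    -- Bounds on the terms of the cosine series, uniform over all x with x * x ≤ M.
    module _ (M : ℕ) {x : ℚ} (x²≤M : x * x ≤ fromℕ M) where

      private
        recip≤1 : ∀ n → recip (suc n) ≤ 1ℚ
        recip≤1 n = recip-antitone 1 (suc n) (ℕ.s≤s ℕ.z≤n)

      cosTerm-growth : ∀ k → cosTerm x k ≤ fromℕ M ^ℚ k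
      cosTerm-growth zero    = ℚ.≤-refl
      cosTerm-growth (suc k) = begin
        cosTerm x (suc k)                       ≡⟨ cosTerm-step x k ⟩
        cosTerm x k * ((x * x * r₁) * r₂)       ≤⟨ mono-* (0≤cosTerm x k) (0≤fromℕ M) (cosTerm-growth k) factor ⟩
        fromℕ M ^ℚ k * fromℕ M                  ≡⟨ ℚ.*-comm (fromℕ M ^ℚ k) (fromℕ M) ⟩
        fromℕ M * fromℕ M ^ℚ k                  ∎
        where
        open ℚ.≤-Reasoning
        r₁ = recip (suc (2 ℕ.* k))
        r₂ = recip (suc (suc (2 ℕ.* k)))
        0≤fromℕ : ∀ n → 0ℚ ≤ fromℕ n
        0≤fromℕ n = fromℕ-mono {0} {n} ℕ.z≤n
        factor : (x * x * r₁) * r₂ ≤ fromℕ M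
        factor = begin
          (x * x * r₁) * r₂       ≤⟨ mono-* (0≤* (square-nonneg x) (0≤recip (suc (2 ℕ.* k)))) (ℚ.nonNegative⁻¹ 1ℚ)
                                       (mono-* (square-nonneg x) (ℚ.nonNegative⁻¹ 1ℚ) x²≤M (recip≤1 (2 ℕ.* k)))
                                       (recip≤1 (suc (2 ℕ.* k))) ⟩
          (fromℕ M * 1ℚ) * 1ℚ     ≡⟨ ℚ.*-identityʳ (fromℕ M * 1ℚ) ⟩
          fromℕ M * 1ℚ            ≡⟨ ℚ.*-identityʳ (fromℕ M) ⟩
          fromℕ M                 ∎

      cosTerm-ratio : ∀ k → M ℕ.≤ k → cosTerm x (suc k) ≤ cosTerm x k * recip (suc k)
      cosTerm-ratio k M≤k = begin
        cosTerm x (suc k)                       ≡⟨ cosTerm-step x k ⟩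
        cosTerm x k * ((x * x * r₁) * r₂)       ≤⟨ ℚ.*-monoˡ-≤-nonNeg (cosTerm x k) {{ℚ.nonNegative (0≤cosTerm x k)}} factor ⟩
        cosTerm x k * recip (suc k)             ∎
        where
        open ℚ.≤-Reasoning
        r₁ = recip (suc (2 ℕ.* k))
        r₂ = recip (suc (suc (2 ℕ.* k)))
        k≤2k : k ℕ.≤ 2 ℕ.* k
        k≤2k = ℕ.m≤m+n k (k ℕ.+ 0)
        first : x * x * r₁ ≤ 1ℚ
        first = ℚ.≤-trans
          (ℚ.*-monoʳ-≤-nonNeg r₁ {{ℚ.nonNegative (0≤recip (suc (2 ℕ.* k)))}} x²≤M)
          (fraction≤1 (suc (2 ℕ.* k)) (ℕ.m≤n⇒m≤1+n (ℕ.≤-trans M≤k k≤2k)))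
        factor : (x * x * r₁) * r₂ ≤ recip (suc k)
        factor = begin
          (x * x * r₁) * r₂   ≤⟨ mono-* (0≤* (square-nonneg x) (0≤recip (suc (2 ℕ.* k)))) (0≤recip (suc k)) first
                                   (recip-antitone (suc k) (suc (suc (2 ℕ.* k))) (ℕ.s≤s (ℕ.m≤n⇒m≤1+n k≤2k))) ⟩
          1ℚ * recip (suc k)  ≡⟨ ℚ.*-identityˡ (recip (suc k)) ⟩
          recip (suc k)       ∎

      cosTerm-decreasing : ∀ k → M ℕ.≤ k → cosTerm x (suc k) ≤ cosTerm x k
      cosTerm-decreasing k M≤k = begin
        cosTerm x (suc k)             ≤⟨ cosTerm-ratio k M≤k ⟩
        cosTerm x k * recip (suc k)   ≤⟨ ℚ.*-monoˡ-≤-nonNeg (cosTerm x k) {{ℚ.nonNegative (0≤cosTerm x k)}} (recip≤1 k) ⟩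
        cosTerm x k * 1ℚ              ≡⟨ ℚ.*-identityʳ (cosTerm x k) ⟩
        cosTerm x k                   ∎
        where open ℚ.≤-Reasoning

      cosTerm-bounded : ∀ j → cosTerm x (j ℕ.+ M) ≤ fromℕ M ^ℚ M
      cosTerm-bounded zero    = cosTerm-growth M
      cosTerm-bounded (suc j) = ℚ.≤-trans (cosTerm-decreasing (j ℕ.+ M) (ℕ.m≤n+m M j)) (cosTerm-bounded j)

      cosTerm-tail : ∀ j → cosTerm x (suc (j ℕ.+ M)) ≤ fromℕ M ^ℚ M * recip (suc (j ℕ.+ M))
      cosTerm-tail j = ℚ.≤-trans (cosTerm-ratio (j ℕ.+ M) (ℕ.m≤n+m M j))
        (ℚ.*-monoʳ-≤-nonNeg (recip (suc (j ℕ.+ M))) {{ℚ.nonNegative (0≤recip (suc (j ℕ.+ M)))}} (cosTerm-bounded j))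

    cauchy-^ : ∀ x m → Cauchy x → Cauchy (λ n → x n ^ℚ m)
    cauchy-^ x zero    cx = cauchy-const 1ℚ
    cauchy-^ x (suc m) cx = cauchy-* x (λ n → x n ^ℚ m) cx (cauchy-^ x m cx)

    cauchy-cosTerm : ∀ x k → Cauchy x → Cauchy (λ n → cosTerm (x n) k)
    cauchy-cosTerm x k cx = cauchy-* (λ n → x n ^ℚ (2 ℕ.* k)) (λ _ → c) (cauchy-^ x (2 ℕ.* k) cx) (cauchy-const c)
      where c = recip ((2 ℕ.* k) !) {{(2 ℕ.* k) ℕ.!≢0}}

  cosSum-diagonal : ∀ x → Cauchy x → Cauchy (λ n → cosSum (x n) n)
  cosSum-diagonal x cx ε 0<ε = N , close
    where
    bounded = cauchy-bounded x cx
    B  = proj₁ bounded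
    N₀ = proj₁ (proj₂ bounded)
    M  = proj₁ (archimedean (B * B))

    x²≤M : ∀ n → N₀ ℕ.≤ n → x n * x n ≤ fromℕ M
    x²≤M n N₀≤n = ℚ.≤-trans (square-bound (x n) B (proj₂ (proj₂ bounded) n N₀≤n)) (proj₂ (archimedean (B * B)))

    δ = ½ * (½ * ε)
    small = recip-small (fromℕ M ^ℚ M) δ (0<½* (0<½* 0<ε))
    N₁ = proj₁ small
    K = suc (N₁ ℕ.+ M)
    settled = cauchy-alternating (λ k n → cosTerm (x n) k) K (λ k → cauchy-cosTerm x k cx) (½ * ε) (0<½* 0<ε)
    N₂ = proj₁ settled
    N = N₀ ⊔ (K ⊔ N₂)

    N₀≤ : ∀ {n} → N ℕ.≤ n → N₀ ℕ.≤ n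
    N₀≤ = ℕ.≤-trans (ℕ.m≤m⊔n N₀ (K ⊔ N₂))
    K≤ : ∀ {n} → N ℕ.≤ n → K ℕ.≤ n
    K≤ = ℕ.≤-trans (ℕ.≤-trans (ℕ.m≤m⊔n K N₂) (ℕ.m≤n⊔m N₀ (K ⊔ N₂)))
    N₂≤ : ∀ {n} → N ℕ.≤ n → N₂ ℕ.≤ n
    N₂≤ = ℕ.≤-trans (ℕ.≤-trans (ℕ.m≤n⊔m K N₂) (ℕ.m≤n⊔m N₀ (K ⊔ N₂)))

    tail : ∀ n → N ℕ.≤ n → abs (cosSum (x n) n - cosSum (x n) K) < δ
    tail n N≤n = begin-strict
      abs (cosSum (x n) n - cosSum (x n) K)
        ≤⟨ alternating-tail (cosTerm (x n)) K n (K≤ N≤n) (0≤cosTerm (x n)) (λ i K≤i → cosTerm-decreasing M {x n}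
             (x²≤M n (N₀≤ N≤n)) i (ℕ.≤-trans (ℕ.m≤n⇒m≤1+n (ℕ.m≤n+m M N₁)) K≤i)) ⟩
      cosTerm (x n) K         ≤⟨ cosTerm-tail M {x n} (x²≤M n (N₀≤ N≤n)) N₁ ⟩
      fromℕ M ^ℚ M * recip K  <⟨ proj₂ small (N₁ ℕ.+ M) (ℕ.m≤m+n N₁ M) ⟩
      δ                       ∎
      where open ℚ.≤-Reasoning

    via : ∀ p q r s → p - s ≡ ((p - q) - (s - r)) + (q - r)
    via = solve 4 (λ p q r s → p :- s := ((p :- q) :- (s :- r)) :+ (q :- r)) refl

    close : ∀ m n → N ℕ.≤ m → N ℕ.≤ n → abs (cosSum (x m) m - cosSum (x n) n) < ε
    close m n N≤m N≤n = begin-strict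
      abs (cm - cn)                                ≡⟨ cong abs (via cm dm dn cn) ⟩
      abs (((cm - dm) - (cn - dn)) + (dm - dn))    ≤⟨ ℚ.∣p+q∣≤∣p∣+∣q∣ ((cm - dm) - (cn - dn)) (dm - dn) ⟩
      abs ((cm - dm) - (cn - dn)) + abs (dm - dn)  ≤⟨ ℚ.+-monoˡ-≤ (abs (dm - dn)) (ℚ.∣p-q∣≤∣p∣+∣q∣ (cm - dm) (cn - dn)) ⟩
      abs (cm - dm) + abs (cn - dn) + abs (dm - dn)
        <⟨ ℚ.+-mono-< (ℚ.+-mono-< (tail m N≤m) (tail n N≤n)) (proj₂ settled m n (N₂≤ N≤m) (N₂≤ N≤n)) ⟩
      δ + δ + ½ * ε                                ≡⟨ cong (λ q → q + ½ * ε) (½+½ (½ * ε)) ⟩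
      ½ * ε + ½ * ε                                ≡⟨ ½+½ ε ⟩
      ε                                            ∎
      where
      open ℚ.≤-Reasoning
      cm = cosSum (x m) m
      cn = cosSum (x n) n
      dm = cosSum (x m) K
      dn = cosSum (x n) K

  abstract
    cauchy-cosSum : ∀ x → Cauchy x → Cauchy (λ n → cosSum (x n) n)
    cauchy-cosSum = cosSum-diagonal

-- Reals are Cauchy sequences of rationals; _≃_ is their equality.  The modulus
-- of convergence is the witness N in Cauchy.

record ℝ : Set where
  constructor mkℝ
  field
    seq    : ℕ → ℚ
    cauchy : Cauchy seq
open ℝ public

infix  4 _≃_
infixl 6 _+_ _-_
infixl 7 _*_
infix  8 -_

record _≃_ (x y : ℝ) : Set where
  constructor mk≃
  field difference-null : Null (λ n → seq x n ℚ.- seq y n)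
open _≃_ public

fromℚ : ℚ → ℝ
fromℚ q = mkℝ (λ _ → q) (cauchy-const q)

fromℕ : ℕ → ℝ
fromℕ n = fromℚ (+ n ℚ./ 1)

0ℝ 1ℝ : ℝ
0ℝ = fromℚ 0ℚ
1ℝ = fromℚ 1ℚ

_+_ _*_ : ℝ → ℝ → ℝ
_+_ x y = mkℝ (λ n → seq x n ℚ.+ seq y n) (cauchy-+ (seq x) (seq y) (cauchy x) (cauchy y))
_*_ x y = mkℝ (λ n → seq x n ℚ.* seq y n) (cauchy-* (seq x) (seq y) (cauchy x) (cauchy y))

-_ : ℝ → ℝ
-_ x = mkℝ (λ n → ℚ.- seq x n) (cauchy-neg (seq x) (cauchy x))

_-_ : ℝ → ℝ → ℝ
_-_ x y = x + (- y)

abs : ℝ → ℝ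
abs x = mkℝ (λ n → ℚ.∣ seq x n ∣) (cauchy-abs (seq x) (cauchy x))

Positive : ℝ → Set
Positive x = ∃[ δ ] 0ℚ ℚ.< δ × (∃[ N ] ∀ n → N ℕ.≤ n → δ ℚ.< seq x n)

-- Leibniz's series: π / 4 = 1 - 1/3 + 1/5 - ⋯
π : ℝ
π = fromℕ 4 * mkℝ leibnizSum cauchy-leibnizSum

-- The cosine series at x.  The n-th rational approximation is the sum of the
-- first n terms of the series, evaluated at the n-th approximation of x.
cos : ℝ → ℝ
cos x = mkℝ (λ n → cosSum (seq x n) n) (cauchy-cosSum (seq x) (cauchy x))

λₚ : (p : ℕ) .{{_ : NonZero p}} → ℝ
λₚ p = fromℕ 2 * cos (π * fromℚ (recip p))

module _ where
  open NullSeq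

  ≃-pointwise : ∀ {x y} → (∀ n → seq x n ≡ seq y n) → x ≃ y
  ≃-pointwise {x} {y} x≗y = mk≃ (small-zero (λ n → trans
    (cong (ℚ._- seq y n) (x≗y n)) (ℚ.+-inverseʳ (seq y n))))

  private
    open ℚSolver.+-*-Solver

    difference-cong : ∀ (f : ℕ → ℚ) {g : ℕ → ℚ} → (∀ n → g n ≡ f n) → Null f → Null g
    difference-cong f {g} g≗f = small-cong {g} {f} g≗f

    sym-≡ : ∀ p q → q ℚ.- p ≡ ℚ.- (p ℚ.- q)
    sym-≡ = solve 2 (λ p q → q :- p := :- (p :- q)) refl

    trans-≡ : ∀ p q r → p ℚ.- r ≡ (p ℚ.- q) ℚ.+ (q ℚ.- r)
    trans-≡ = solve 3 (λ p q r → p :- r := (p :- q) :+ (q :- r)) refl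

    +-≡ : ∀ a b c d → (a ℚ.+ c) ℚ.- (b ℚ.+ d) ≡ (a ℚ.- b) ℚ.+ (c ℚ.- d)
    +-≡ = solve 4 (λ a b c d → (a :+ c) :- (b :+ d) := (a :- b) :+ (c :- d)) refl

    *-≡ : ∀ a b c d → (a ℚ.* c) ℚ.- (b ℚ.* d) ≡ c ℚ.* (a ℚ.- b) ℚ.+ b ℚ.* (c ℚ.- d)
    *-≡ = solve 4 (λ a b c d → (a :* c) :- (b :* d) := c :* (a :- b) :+ b :* (c :- d)) refl

    neg-≡ : ∀ a b → (ℚ.- a) ℚ.- (ℚ.- b) ≡ ℚ.- (a ℚ.- b)
    neg-≡ = solve 2 (λ a b → (:- a) :- (:- b) := :- (a :- b)) refl

    infixl 6 _⊖_
    _⊖_ : ℝ → ℝ → ℕ → ℚ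
    (x ⊖ y) n = seq x n ℚ.- seq y n

  ≃-refl : ∀ {x} → x ≃ x
  ≃-refl = ≃-pointwise (λ _ → refl)

  ≃-sym : ∀ {x y} → x ≃ y → y ≃ x
  ≃-sym {x} {y} (mk≃ x≃y) = mk≃ (difference-cong (λ n → ℚ.- (x ⊖ y) n)
    (λ n → sym-≡ (seq x n) (seq y n)) (small-neg {x ⊖ y} x≃y))

  ≃-trans : ∀ {x y z} → x ≃ y → y ≃ z → x ≃ z
  ≃-trans {x} {y} {z} (mk≃ x≃y) (mk≃ y≃z) = mk≃ (difference-cong (λ n → (x ⊖ y) n ℚ.+ (y ⊖ z) n)
    (λ n → trans-≡ (seq x n) (seq y n) (seq z n)) (small-+ {x ⊖ y} {y ⊖ z} x≃y y≃z))

  +-cong : ∀ {x x' y y'} → x ≃ x' → y ≃ y' → x + y ≃ x' + y'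
  +-cong {x} {x'} {y} {y'} (mk≃ p) (mk≃ q) = mk≃ (difference-cong (λ n → (x ⊖ x') n ℚ.+ (y ⊖ y') n)
    (λ n → +-≡ (seq x n) (seq x' n) (seq y n) (seq y' n)) (small-+ {x ⊖ x'} {y ⊖ y'} p q))

  -‿cong : ∀ {x y} → x ≃ y → - x ≃ - y
  -‿cong {x} {y} (mk≃ p) = mk≃ (difference-cong (λ n → ℚ.- (x ⊖ y) n)
    (λ n → neg-≡ (seq x n) (seq y n)) (small-neg {x ⊖ y} p))

  *-cong : ∀ {x x' y y'} → x ≃ x' → y ≃ y' → x * y ≃ x' * y'
  *-cong {x} {x'} {y} {y'} (mk≃ p) (mk≃ q) = mk≃ (difference-cong
    (λ n → seq y n ℚ.* (x ⊖ x') n ℚ.+ seq x' n ℚ.* (y ⊖ y') n)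
    (λ n → *-≡ (seq x n) (seq x' n) (seq y n) (seq y' n))
    (small-+ {λ n → seq y n ℚ.* (x ⊖ x') n} {λ n → seq x' n ℚ.* (y ⊖ y') n}
      (small-* {seq y} {x ⊖ x'} (cauchy-bounded (seq y) (cauchy y)) p)
      (small-* {seq x'} {y ⊖ y'} (cauchy-bounded (seq x') (cauchy x')) q)))

  private
    factor-≡ : ∀ a b c → a ℚ.* b ℚ.- a ℚ.* c ≡ a ℚ.* (b ℚ.- c)
    factor-≡ = solve 3 (λ a b c → a :* b :- a :* c := a :* (b :- c)) refl

  *-cancelˡ-positive : ∀ {x y z} → Positive x → x * y ≃ x * z → y ≃ z
  *-cancelˡ-positive {x} {y} {z} (δ , 0<δ , N , δ<x) (mk≃ p) = mk≃
    (small-dominated {y ⊖ z} {λ n → δ⁻¹ ℚ.* (x * y ⊖ x * z) n} (N , bound)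
      (small-scale {x * y ⊖ x * z} δ⁻¹ p))
    where
    instance
      δ-pos : ℚ.Positive δ
      δ-pos = ℚ.positive 0<δ
    δ⁻¹ = ℚ.1/_ δ {{ℚ.pos⇒nonZero δ}}
    bound : ∀ n → N ℕ.≤ n → ℚ.∣ (y ⊖ z) n ∣ ℚ.≤ ℚ.∣ δ⁻¹ ℚ.* (x * y ⊖ x * z) n ∣
    bound n N≤n = begin
      ℚ.∣ d ∣                           ≡⟨ ℚ.*-identityˡ ℚ.∣ d ∣ ⟨
      1ℚ ℚ.* ℚ.∣ d ∣                    ≡⟨ cong (ℚ._* ℚ.∣ d ∣) (ℚ.*-inverseˡ δ {{ℚ.pos⇒nonZero δ}}) ⟨
      δ⁻¹ ℚ.* δ ℚ.* ℚ.∣ d ∣             ≡⟨ ℚ.*-assoc δ⁻¹ δ ℚ.∣ d ∣ ⟩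
      δ⁻¹ ℚ.* (δ ℚ.* ℚ.∣ d ∣)           ≤⟨ ℚ.*-monoˡ-≤-nonNeg δ⁻¹ {{ℚ.pos⇒nonNeg δ⁻¹ {{ℚ.1/pos⇒pos δ}}}}
                                             (ℚ.*-monoʳ-≤-nonNeg ℚ.∣ d ∣ {{ℚ.∣-∣-nonNeg d}} (ℚ.<⇒≤ (δ<x n N≤n))) ⟩
      δ⁻¹ ℚ.* (seq x n ℚ.* ℚ.∣ d ∣)     ≡⟨ cong (λ q → δ⁻¹ ℚ.* (q ℚ.* ℚ.∣ d ∣)) (ℚ.0≤p⇒∣p∣≡p (ℚ.<⇒≤ (ℚ.<-trans 0<δ (δ<x n N≤n)))) ⟨
      δ⁻¹ ℚ.* (ℚ.∣ seq x n ∣ ℚ.* ℚ.∣ d ∣) ≡⟨ cong (δ⁻¹ ℚ.*_) (ℚ.∣p*q∣≡∣p∣*∣q∣ (seq x n) d) ⟨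
      δ⁻¹ ℚ.* ℚ.∣ seq x n ℚ.* d ∣       ≡⟨ cong (ℚ._* ℚ.∣ seq x n ℚ.* d ∣) (ℚ.0≤p⇒∣p∣≡p (ℚ.<⇒≤ (ℚ.positive⁻¹ δ⁻¹ {{ℚ.1/pos⇒pos δ}}))) ⟨
      ℚ.∣ δ⁻¹ ∣ ℚ.* ℚ.∣ seq x n ℚ.* d ∣ ≡⟨ ℚ.∣p*q∣≡∣p∣*∣q∣ δ⁻¹ (seq x n ℚ.* d) ⟨
      ℚ.∣ δ⁻¹ ℚ.* (seq x n ℚ.* d) ∣     ≡⟨ cong (λ q → ℚ.∣ δ⁻¹ ℚ.* q ∣) (factor-≡ (seq x n) (seq y n) (seq z n)) ⟨
      ℚ.∣ δ⁻¹ ℚ.* (x * y ⊖ x * z) n ∣   ∎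
      where
      open ℚ.≤-Reasoning
      d = (y ⊖ z) n

ℝ-commutativeRing : CommutativeRing 0ℓ 0ℓ
ℝ-commutativeRing = record
  { Carrier = ℝ ; _≈_ = _≃_ ; _+_ = _+_ ; _*_ = _*_ ; -_ = -_ ; 0# = 0ℝ ; 1# = 1ℝ
  ; isCommutativeRing = record
    { isRing = record
      { +-isAbelianGroup = record
        { isGroup = record
          { isMonoid = record
            { isSemigroup = record
              { isMagma = record
                { isEquivalence = record { refl = ≃-refl ; sym = ≃-sym ; trans = ≃-trans }
                ; ∙-cong        = +-cong
                }
              ; assoc = λ x y z → ≃-pointwise (λ n → ℚ.+-assoc (seq x n) (seq y n) (seq z n))
              }
            ; identity = (λ x → ≃-pointwise (λ n → ℚ.+-identityˡ (seq x n)))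
                       , (λ x → ≃-pointwise (λ n → ℚ.+-identityʳ (seq x n)))
            }
          ; inverse = (λ x → ≃-pointwise (λ n → ℚ.+-inverseˡ (seq x n)))
                    , (λ x → ≃-pointwise (λ n → ℚ.+-inverseʳ (seq x n)))
          ; ⁻¹-cong = -‿cong
          }
        ; comm = λ x y → ≃-pointwise (λ n → ℚ.+-comm (seq x n) (seq y n))
        }
      ; *-cong     = *-cong
      ; *-assoc    = λ x y z → ≃-pointwise (λ n → ℚ.*-assoc (seq x n) (seq y n) (seq z n))
      ; *-identity = (λ x → ≃-pointwise (λ n → ℚ.*-identityˡ (seq x n)))
                   , (λ x → ≃-pointwise (λ n → ℚ.*-identityʳ (seq x n)))
      ; distrib    = (λ x y z → ≃-pointwise (λ n → ℚ.*-distribˡ-+ (seq x n) (seq y n) (seq z n)))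
                   , (λ x y z → ≃-pointwise (λ n → ℚ.*-distribʳ-+ (seq x n) (seq y n) (seq z n)))
      }
    ; *-comm = λ x y → ≃-pointwise (λ n → ℚ.*-comm (seq x n) (seq y n))
    }
  }

0≄1 : ¬ 0ℝ ≃ 1ℝ
0≄1 (mk≃ p) = let N , 1<½ = p ½ (ℚ.positive⁻¹ ½) in
  ℚ.<-irrefl refl (ℚ.<-trans (1<½ N ℕ.≤-refl) ½<1)
  where
  ½<1 : ½ ℚ.< 1ℚ
  ½<1 = ℚ.*<* (ℤ.+<+ (ℕ.s≤s (ℕ.s≤s ℕ.z≤n)))

-- The polygon has vertex set Fin N in cyclic order.  Going round it from i, the
-- vertex k comes strictly before j.
CyclicallyBetween : ∀ {N} → Fin N → Fin N → Fin N → Set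
CyclicallyBetween i k j =
  (i Fin.< k × k Fin.< j) ⊎ (k Fin.< j × j Fin.< i) ⊎ (j Fin.< i × i Fin.< k)

cyclicallyBetween? : ∀ {N} (i k j : Fin N) → Dec (CyclicallyBetween i k j)
cyclicallyBetween? i k j =
  (i Fin.<? k ×-dec k Fin.<? j) ⊎-dec (k Fin.<? j ×-dec j Fin.<? i) ⊎-dec (j Fin.<? i ×-dec i Fin.<? k)

-- In the convex polygon spanned by S, the vertex j immediately follows i.
Next : ∀ {N} → Subset N → Fin N → Fin N → Set
Next S i j = i ∈ S × j ∈ S × i ≢ j × (∀ k → k ∈ S → ¬ CyclicallyBetween i k j)

next? : ∀ {N} (S : Subset N) (i j : Fin N) → Dec (Next S i j)
next? S i j = i ∈? S ×-dec j ∈? S ×-dec ¬? (i Fin.≟ j) ×-dec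
  Fin.all? (λ k → k ∈? S →-dec ¬? (cyclicallyBetween? i k j))

Adjacent : ∀ {N} .{{_ : NonZero N}} → Fin N → Fin N → Set
Adjacent {N} i j = (toℕ j ≡ suc (toℕ i) ℕ.% N) ⊎ (toℕ i ≡ suc (toℕ j) ℕ.% N)

adjacent? : ∀ {N} .{{_ : NonZero N}} (i j : Fin N) → Dec (Adjacent i j)
adjacent? {N} i j = (toℕ j ℕ.≟ suc (toℕ i) ℕ.% N) ⊎-dec (toℕ i ℕ.≟ suc (toℕ j) ℕ.% N)

record NonCrossingDiagonals (N : ℕ) .{{_ : NonZero N}} : Set₁ where
  field
    Diagonal    : Rel (Fin N) 0ℓ
    diagonal?   : Decidable Diagonal
    symmetric   : Symmetric Diagonal
    isDiagonal  : ∀ {i j} → Diagonal i j → i ≢ j × ¬ Adjacent i j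
    nonCrossing : ∀ {a b c d} → a Fin.< b → b Fin.< c → c Fin.< d → Diagonal a c → ¬ Diagonal b d

  -- A set of at least three vertices spans one of the polygons into which the
  -- diagonals cut P when each side of its convex hull is an edge of P or one
  -- of the diagonals, and no diagonal cuts through the hull.
  record IsCell (S : Subset N) : Set where
    field
      polygon  : 3 ℕ.≤ ∣ S ∣
      sides    : ∀ i j → Next S i j → Adjacent i j ⊎ Diagonal i j
      interior : ∀ i j → i ∈ S → j ∈ S → Diagonal i j → Next S i j ⊎ Next S j i

  isCell? : ∀ S → Dec (IsCell S)
  isCell? S = map′
    (λ (p , s , e) → record { polygon = p ; sides = s ; interior = e })
    (λ c → IsCell.polygon c , IsCell.sides c , IsCell.interior c)
    ( 3 ℕ.≤? ∣ S ∣
      ×-dec Fin.all? (λ i → Fin.all? (λ j → next? S i j →-dec (adjacent? i j ⊎-dec diagonal? i j)))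
      ×-dec Fin.all? (λ i → Fin.all? (λ j →
        i ∈? S →-dec j ∈? S →-dec diagonal? i j →-dec (next? S i j ⊎-dec next? S j i))))

record PAngulation (p N : ℕ) .{{_ : NonZero N}} : Set₁ where
  field
    diagonals : NonCrossingDiagonals N
  open NonCrossingDiagonals diagonals public
  field
    p-gons : ∀ S → IsCell S → ∣ S ∣ ≡ p

subsets : ∀ N → List (Subset N)
subsets zero    = Vec.[] ∷ []
subsets (suc N) = List.map (inside Vec.∷_) (subsets N) List.++ List.map (outside Vec.∷_) (subsets N)

-- The number of p-gons of D incident with the vertex α, counted among all vertex sets.
incidence : ∀ {p N} .{{_ : NonZero N}} → PAngulation p N → Fin N → ℕ
incidence {N = N} D α = List.length (List.filter (λ S → isCell? S ×-dec α ∈? S) (subsets N))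
  where open PAngulation D

-- A frieze is indexed by the strip -2 ≤ j - i ≤ n + 1; outside this strip the
-- values m i j are arbitrary.
record IsFrieze (n : ℕ) (m : ℤ → ℤ → ℝ) : Set where
  field
    zeroˡ      : ∀ i → m i (i ℤ.- + 2) ≃ 0ℝ
    zeroʳ      : ∀ i → m i (i ℤ.+ + n ℤ.+ 1ℤ) ≃ 0ℝ
    oneˡ       : ∀ i → m i (i ℤ.- 1ℤ) ≃ 1ℝ
    oneʳ       : ∀ i → m i (i ℤ.+ + n) ≃ 1ℝ
    positive   : ∀ i j → 0ℤ ℤ.≤ j ℤ.- i → j ℤ.- i ℤ.< + n → Positive (m i j)
    unimodular : ∀ i r → -1ℤ ℤ.≤ r → r ℤ.≤ + n →
      m i (i ℤ.+ r) * m (i ℤ.+ 1ℤ) (i ℤ.+ r ℤ.+ 1ℤ) - m (i ℤ.+ 1ℤ) (i ℤ.+ r) * m i (i ℤ.+ r ℤ.+ 1ℤ) ≃ 1ℝ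

residue : ∀ {N} .{{_ : NonZero N}} → ℤ → Fin N
residue {N} i = fromℕ< (n%ℕd<d i N)

IsFriezeOf : {p n : ℕ} .{{_ : NonZero p}} → PAngulation p (3 ℕ.+ n) → (ℤ → ℤ → ℝ) → Set
IsFriezeOf {p} {n} D m = IsFrieze n m × (∀ i → m i i ≃ λₚ p * fromℕ (incidence D (residue i)))

-- The extended real line, in homogeneous coordinates: [ x ∶ y ] is x / y.
record ℝ∞ : Set where
  constructor [_∶_]⟨_⟩
  field
    x y     : ℝ
    nonzero : ¬ (x ≃ 0ℝ × y ≃ 0ℝ)

infix 4 _≈_
_≈_ : ℝ∞ → ℝ∞ → Set
[ a ∶ b ]⟨ _ ⟩ ≈ [ c ∶ d ]⟨ _ ⟩ = a * d ≃ c * b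

∞ : ℝ∞
∞ = [ 1ℝ ∶ 0ℝ ]⟨ (λ (1≃0 , _) → 0≄1 (≃-sym 1≃0)) ⟩

module _ where
  open CommutativeRing ℝ-commutativeRing
    using (ring; +-identityˡ; +-identityʳ; *-identityʳ; zeroʳ; +-congʳ; +-congˡ; *-congˡ; setoid)
  open RingProperties ring using (-‿involutive; -0#≈0#)

  -- z ↦ c - 1 / z, which sends [ x ∶ y ] to [ c x - y ∶ x ].
  möbius : ℝ → ℝ∞ → ℝ∞
  möbius c [ x ∶ y ]⟨ nz ⟩ = [ c * x - y ∶ x ]⟨ (λ (cx-y≃0 , x≃0) → nz (x≃0 , y≃0 cx-y≃0 x≃0)) ⟩
    where
    open ≈-Reasoning setoid
    y≃0 : c * x - y ≃ 0ℝ → x ≃ 0ℝ → y ≃ 0ℝ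
    y≃0 cx-y≃0 x≃0 = begin
      y               ≈⟨ -‿involutive y ⟨
      - (- y)         ≈⟨ -‿cong (+-identityˡ (- y)) ⟨
      - (0ℝ - y)      ≈⟨ -‿cong (+-congʳ (≃-trans (*-congˡ x≃0) (zeroʳ c))) ⟨
      - (c * x - y)   ≈⟨ -‿cong cx-y≃0 ⟩
      - 0ℝ            ≈⟨ -0#≈0# ⟩
      0ℝ              ∎

module _ {p n : ℕ} .{{_ : NonZero p}} (D : PAngulation p (3 ℕ.+ n)) where

  ξ : Fin (3 ℕ.+ n) → ℝ∞ → ℝ∞
  ξ α = möbius (fromℕ (incidence D α) * λₚ p)

  -- ξ₀ ξ₁ ⋯ ξ_{α-1} (∞)
  fareyPoint : Fin (3 ℕ.+ n) → ℝ∞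
  fareyPoint α = foldr ξ ∞ (take (toℕ α) (allFin (3 ℕ.+ n)))

-- A point of the Farey path together with the fraction as which it is written.
record FareyVertex : Set where
  field
    point                 : ℝ∞
    numerator denominator : ℝ
    nonzero               : ¬ (numerator ≃ 0ℝ × denominator ≃ 0ℝ)
    isPoint               : [ numerator ∶ denominator ]⟨ nonzero ⟩ ≈ point

fareyDistance : FareyVertex → FareyVertex → ℝ
fareyDistance u v = abs (a u * b v - a v * b u)
  where open FareyVertex renaming (numerator to a; denominator to b)

module _ {p n : ℕ} .{{_ : NonZero p}} (D : PAngulation p (3 ℕ.+ n))
         (m : ℤ → ℤ → ℝ) (F : IsFriezeOf D m) where
  open IsFrieze (proj₁ F)
  private quiddity = proj₂ F

  private
    module R = CommutativeRing ℝ-commutativeRing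
    open ≈-Reasoning R.setoid
    open ℤSolver.+-*-Solver using (solve; _:+_; _:-_; _:=_; con)
    open ℚSolver.+-*-Solver using () renaming (_:*_ to _⊗_; _:-_ to _⊝_; _:=_ to _⊜_)

    m-cong : ∀ {i i' j j'} → i ≡ i' → j ≡ j' → m i j ≃ m i' j'
    m-cong refl refl = ≃-refl

    Cancellative : ℝ → Set
    Cancellative x = ∀ y z → x * y ≃ x * z → y ≃ z

    one-cancellative : ∀ {x} → x ≃ 1ℝ → Cancellative x
    one-cancellative {x} x≃1 y z xy≃xz = begin
      y        ≈⟨ R.*-identityˡ y ⟨
      1ℝ * y   ≈⟨ R.*-congʳ x≃1 ⟨
      x * y    ≈⟨ xy≃xz ⟩
      x * z    ≈⟨ R.*-congʳ x≃1 ⟩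
      1ℝ * z   ≈⟨ R.*-identityˡ z ⟩
      z        ∎

    entry-cancellative : ∀ r i → r ℕ.≤ n → Cancellative (m (i ℤ.+ 1ℤ) (i ℤ.+ + r))
    entry-cancellative zero i _ = one-cancellative (≃-trans
      (m-cong refl (solve 1 (λ i → i :+ con 0ℤ := (i :+ con 1ℤ) :- con 1ℤ) refl i))
      (oneˡ (i ℤ.+ 1ℤ)))
    entry-cancellative (suc r) i r<n y z = *-cancelˡ-positive (positive (i ℤ.+ 1ℤ) (i ℤ.+ + suc r)
      (subst (0ℤ ℤ.≤_) (sym offset) (ℤ.+≤+ ℕ.z≤n))
      (subst (ℤ._< + n) (sym offset) (ℤ.+<+ r<n)))
      where
      offset : (i ℤ.+ + suc r) ℤ.- (i ℤ.+ 1ℤ) ≡ + r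
      offset = solve 2 (λ i r → (i :+ (con 1ℤ :+ r)) :- (i :+ con 1ℤ) := r) refl i (+ r)

    -- Polynomial identities over ℝ hold term by term.
    step₁ : ∀ A A' B B' → B * A' ≃ A * B' - (A * B' - B * A')
    step₁ A A' B B' = ≃-pointwise (λ k → ℚSolver.+-*-Solver.solve 4
      (λ A A' B B' → B ⊗ A' ⊜ A ⊗ B' ⊝ (A ⊗ B' ⊝ B ⊗ A')) refl
      (seq A k) (seq A' k) (seq B k) (seq B' k))

    step₂ : ∀ q B B' C C' → (q * B - C) * B' - (B * C' - C * B') ≃ B * (q * B' - C')
    step₂ q B B' C C' = ≃-pointwise (λ k → ℚSolver.+-*-Solver.solve 5
      (λ q B B' C C' → (q ⊗ B ⊝ C) ⊗ B' ⊝ (B ⊗ C' ⊝ C ⊗ B') ⊜ B ⊗ (q ⊗ B' ⊝ C')) refl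
      (seq q k) (seq B k) (seq B' k) (seq C k) (seq C' k))

    zero-step : ∀ q → q ≃ q * 1ℝ - 0ℝ
    zero-step q = ≃-pointwise (λ k → ℚSolver.+-*-Solver.solve 1
      (λ q → q ⊜ q ⊗ ℚSolver.+-*-Solver.con 1ℚ ⊝ ℚSolver.+-*-Solver.con 0ℚ) refl (seq q k))

  frieze-recurrence : ∀ r i → r ℕ.≤ suc n →
    m i (i ℤ.+ + r) ≃ m i i * m (i ℤ.+ 1ℤ) (i ℤ.+ + r) - m (i ℤ.+ + 2) (i ℤ.+ + r)
  frieze-recurrence zero i _ = begin
    m i (i ℤ.+ 0ℤ)          ≈⟨ m-cong refl (ℤ.+-identityʳ i) ⟩
    m i i                   ≈⟨ zero-step (m i i) ⟩
    m i i * 1ℝ - 0ℝ         ≈⟨ R.+-cong (R.*-congˡ one) (R.-‿cong nought) ⟨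
    m i i * m (i ℤ.+ 1ℤ) (i ℤ.+ 0ℤ) - m (i ℤ.+ + 2) (i ℤ.+ 0ℤ) ∎
    where
    one : m (i ℤ.+ 1ℤ) (i ℤ.+ 0ℤ) ≃ 1ℝ
    one = ≃-trans (m-cong refl (solve 1 (λ i → i :+ con 0ℤ := (i :+ con 1ℤ) :- con 1ℤ) refl i))
      (oneˡ (i ℤ.+ 1ℤ))
    nought : m (i ℤ.+ + 2) (i ℤ.+ 0ℤ) ≃ 0ℝ
    nought = ≃-trans (m-cong refl (solve 1 (λ i → i :+ con 0ℤ := (i :+ con (+ 2)) :- con (+ 2)) refl i))
      (zeroˡ (i ℤ.+ + 2))
  frieze-recurrence (suc r) i (ℕ.s≤s r≤n) = ≃-trans (m-cong refl j'≡)
    (≃-trans main (R.+-cong (R.*-congˡ (m-cong refl (sym j'≡))) (R.-‿cong (m-cong refl (sym j'≡)))))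
    where
    j = i ℤ.+ + r
    j' = i ℤ.+ + r ℤ.+ 1ℤ
    j'≡ : i ℤ.+ + suc r ≡ j'
    j'≡ = solve 2 (λ i r → i :+ (con 1ℤ :+ r) := i :+ r :+ con 1ℤ) refl i (+ r)
    q = m i i
    A = m i j
    A' = m i j'
    B = m (i ℤ.+ 1ℤ) j
    B' = m (i ℤ.+ 1ℤ) j'
    C = m (i ℤ.+ + 2) j
    C' = m (i ℤ.+ + 2) j'
    i+2 : (i ℤ.+ 1ℤ) ℤ.+ 1ℤ ≡ i ℤ.+ + 2
    i+2 = solve 1 (λ i → (i :+ con 1ℤ) :+ con 1ℤ := i :+ con (+ 2)) refl i
    j≡ : (i ℤ.+ 1ℤ) ℤ.+ (+ r ℤ.- 1ℤ) ≡ j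
    j≡ = solve 2 (λ i r → (i :+ con 1ℤ) :+ (r :- con 1ℤ) := i :+ r) refl i (+ r)
    j+1≡ : (i ℤ.+ 1ℤ) ℤ.+ (+ r ℤ.- 1ℤ) ℤ.+ 1ℤ ≡ j'
    j+1≡ = cong (ℤ._+ 1ℤ) j≡
    unimodular₁ : A * B' - B * A' ≃ 1ℝ
    unimodular₁ = unimodular i (+ r) ℤ.-≤+ (ℤ.+≤+ r≤n)
    unimodular₂ : B * C' - C * B' ≃ 1ℝ
    unimodular₂ = ≃-trans
      (R.+-cong (R.*-cong (m-cong refl (sym j≡)) (m-cong (sym i+2) (sym j+1≡)))
        (R.-‿cong (R.*-cong (m-cong (sym i+2) (sym j≡)) (m-cong refl (sym j+1≡)))))
      (unimodular (i ℤ.+ 1ℤ) (+ r ℤ.- 1ℤ) (lower r)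
        (ℤ.≤-trans (ℤ.i-j≤i (+ r) 1ℤ) (ℤ.+≤+ r≤n)))
      where
      lower : ∀ r → -1ℤ ℤ.≤ + r ℤ.- 1ℤ
      lower zero    = ℤ.≤-refl
      lower (suc r) = ℤ.-≤+
    main : A' ≃ q * B' - C'
    main = entry-cancellative r i r≤n A' (q * B' - C') (begin
      B * A'                                      ≈⟨ step₁ A A' B B' ⟩
      A * B' - (A * B' - B * A')                  ≈⟨ R.+-cong (R.*-congʳ (frieze-recurrence r i (ℕ.m≤n⇒m≤1+n r≤n)))
                                                       (R.-‿cong (≃-trans unimodular₁ (≃-sym unimodular₂))) ⟩
      (q * B - C) * B' - (B * C' - C * B')        ≈⟨ step₂ q B B' C C' ⟩
      B * (q * B' - C')                           ∎)

  private
    residue-toℕ : (α : Fin (3 ℕ.+ n)) → residue (+ toℕ α) ≡ α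
    residue-toℕ α = trans (Fin.fromℕ<-cong _ _ (ℕ.m<n⇒m%n≡m (Fin.toℕ<n α)) _ (Fin.toℕ<n α))
      (Fin.fromℕ<-toℕ α (Fin.toℕ<n α))

    coefficient : ∀ α → fromℕ (incidence D α) * λₚ p ≃ m (+ toℕ α) (+ toℕ α)
    coefficient α = begin
      fromℕ (incidence D α) * λₚ p                        ≈⟨ R.*-comm (fromℕ (incidence D α)) (λₚ p) ⟩
      λₚ p * fromℕ (incidence D α)                        ≡⟨ cong (λ β → λₚ p * fromℕ (incidence D β)) (residue-toℕ α) ⟨
      λₚ p * fromℕ (incidence D (residue (+ toℕ α)))      ≈⟨ quiddity (+ toℕ α) ⟨
      m (+ toℕ α) (+ toℕ α)                               ∎

    path-coordinates : ∀ len (f : Fin len → Fin (3 ℕ.+ n)) s k →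
      (∀ i → toℕ (f i) ≡ s ℕ.+ toℕ i) → k ℕ.≤ len → k ℕ.≤ 2 ℕ.+ n →
      ℝ∞.x (foldr (ξ D) ∞ (take k (tabulate f))) ≃ m (+ s) (+ (s ℕ.+ k) ℤ.- 1ℤ) ×
      ℝ∞.y (foldr (ξ D) ∞ (take k (tabulate f))) ≃ m (+ s ℤ.+ 1ℤ) (+ (s ℕ.+ k) ℤ.- 1ℤ)
    path-coordinates len f s zero f≡ _ _ =
      ≃-sym (≃-trans (m-cong refl (cong (λ t → + t ℤ.- 1ℤ) (ℕ.+-identityʳ s))) (oneˡ (+ s))) ,
      ≃-sym (≃-trans (m-cong refl (trans (cong (λ t → + t ℤ.- 1ℤ) (ℕ.+-identityʳ s))
        (solve 1 (λ s → s :- con 1ℤ := (s :+ con 1ℤ) :- con (+ 2)) refl (+ s)))) (zeroˡ (+ s ℤ.+ 1ℤ)))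
    path-coordinates (suc len) f s (suc k) f≡ (ℕ.s≤s k≤len) (ℕ.s≤s k≤) =
      (begin
        fromℕ (incidence D (f Fin.zero)) * λₚ p * ℝ∞.x z - ℝ∞.y z
          ≈⟨ R.+-cong (R.*-cong head (proj₁ IH)) (R.-‿cong (proj₂ IH)) ⟩
        m (+ s) (+ s) * m (+ suc s) (+ (suc s ℕ.+ k) ℤ.- 1ℤ) - m (+ suc s ℤ.+ 1ℤ) (+ (suc s ℕ.+ k) ℤ.- 1ℤ)
          ≈⟨ R.+-cong (R.*-congˡ (m-cong suc≡ j≡)) (R.-‿cong (m-cong suc+1≡ j≡)) ⟩
        m (+ s) (+ s) * m (+ s ℤ.+ 1ℤ) (+ s ℤ.+ + k) - m (+ s ℤ.+ + 2) (+ s ℤ.+ + k)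
          ≈⟨ frieze-recurrence k (+ s) k≤ ⟨
        m (+ s) (+ s ℤ.+ + k)
          ≈⟨ m-cong refl (trans (sym j≡) shift) ⟩
        m (+ s) (+ (s ℕ.+ suc k) ℤ.- 1ℤ) ∎) ,
      ≃-trans (proj₁ IH) (m-cong suc≡ shift)
      where
      z = foldr (ξ D) ∞ (take k (tabulate (f ∘ Fin.suc)))
      IH = path-coordinates len (f ∘ Fin.suc) (suc s) k
        (λ i → trans (f≡ (Fin.suc i)) (ℕ.+-suc s (toℕ i))) k≤len (ℕ.m≤n⇒m≤1+n k≤)
      head : fromℕ (incidence D (f Fin.zero)) * λₚ p ≃ m (+ s) (+ s)
      head = ≃-trans (coefficient (f Fin.zero)) (m-cong f0 f0)
        where
        f0 : + toℕ (f Fin.zero) ≡ + s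
        f0 = cong +_ (trans (f≡ Fin.zero) (ℕ.+-identityʳ s))
      suc≡ : + suc s ≡ + s ℤ.+ 1ℤ
      suc≡ = ℤ.+-comm 1ℤ (+ s)
      suc+1≡ : + suc s ℤ.+ 1ℤ ≡ + s ℤ.+ + 2
      suc+1≡ = solve 1 (λ s → (con 1ℤ :+ s) :+ con 1ℤ := s :+ con (+ 2)) refl (+ s)
      j≡ : + (suc s ℕ.+ k) ℤ.- 1ℤ ≡ + s ℤ.+ + k
      j≡ = solve 2 (λ s k → (con 1ℤ :+ (s :+ k)) :- con 1ℤ := s :+ k) refl (+ s) (+ k)
      shift : + (suc s ℕ.+ k) ℤ.- 1ℤ ≡ + (s ℕ.+ suc k) ℤ.- 1ℤ
      shift = cong (λ t → + t ℤ.- 1ℤ) (sym (ℕ.+-suc s k))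

    fareyPoint-coordinates : ∀ α →
      ℝ∞.x (fareyPoint D α) ≃ m 0ℤ (+ toℕ α ℤ.- 1ℤ) ×
      ℝ∞.y (fareyPoint D α) ≃ m 1ℤ (+ toℕ α ℤ.- 1ℤ)
    fareyPoint-coordinates α = path-coordinates (3 ℕ.+ n) (λ i → i) 0 (toℕ α) (λ _ → refl)
      (ℕ.<⇒≤ (Fin.toℕ<n α)) (ℕ.≤-pred (Fin.toℕ<n α))

  fareyVertex : Fin (3 ℕ.+ n) → FareyVertex
  fareyVertex α = record
    { point       = fareyPoint D α
    ; numerator   = m 0ℤ (+ toℕ α ℤ.- 1ℤ)
    ; denominator = m 1ℤ (+ toℕ α ℤ.- 1ℤ)
    ; nonzero     = λ (a≃0 , b≃0) → ℝ∞.nonzero (fareyPoint D α) (≃-trans x≃a a≃0 , ≃-trans y≃b b≃0)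
    ; isPoint     = *-cong (≃-sym x≃a) y≃b
    }
    where
    x≃a = proj₁ (fareyPoint-coordinates α)
    y≃b = proj₂ (fareyPoint-coordinates α)

{-# OPTIONS --safe #-}

-- Write ⟨x , y⟩ = m (x + 1) (y - 1) for vertices x ≤ y ≤ x + N of the N-gon, where
-- N = n + 3.  The frieze recurrence, applied repeatedly in the left index, shows that
-- ⟨α , β⟩ = ⟨b , α⟩ ⟨b + 1 , β⟩ - ⟨b , β⟩ ⟨b + 1 , α⟩ whenever b < α ≤ β ≤ b + N.
-- With b = -1 the right-hand side is the determinant in the Farey distance.  With
-- β = b + N it gives the glide symmetry ⟨x , y⟩ = ⟨y , x + N⟩, and hence periodicity,
-- which reduces arbitrary indices to 0 ≤ α ≤ β < N.  The absolute value is harmless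
-- because all entries in the strip are 0, 1 or positive.
module Submission where

open import Data.Integer.Base as ℤ using (ℤ; +_; -[1+_]; 0ℤ; 1ℤ; -1ℤ)
open import Data.Nat.Base as ℕ using (ℕ; NonZero)
open import Defs

open import Algebra.Bundles using (CommutativeRing)
open import Data.Fin.Base using (Fin; toℕ)
import Data.Fin.Properties as Fin
open import Data.Integer.DivMod using (_/ℕ_; n%ℕd<d; a≡a%ℕn+[a/ℕn]*n)
import Data.Integer.Properties as ℤ
import Data.Integer.Solver as ℤSolver
import Data.Nat.Properties as ℕ
open import Data.Product.Base using (_,_; proj₁)
open import Data.Rational.Base as ℚ using (0ℚ; 1ℚ)
import Data.Rational.Properties as ℚ
import Data.Rational.Solver as ℚSolver
open import Data.Sum.Base using (_⊎_; inj₁; inj₂; [_,_]′)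
open import Relation.Binary.Definitions using (Tri; tri<; tri≈; tri>)
open import Relation.Binary.PropositionalEquality
  using (_≡_; refl; sym; trans; cong; cong₂; subst; subst₂; module ≡-Reasoning)
import Relation.Binary.Reasoning.Setoid as ≈-Reasoning
open import Relation.Nullary using (yes; no)

private
  module R = CommutativeRing ℝ-commutativeRing
  module ℤS = ℤSolver.+-*-Solver
  module ℚS = ℚSolver.+-*-Solver

-- Absolute values of reals and the symmetry of the Farey distance.

abs-cong : ∀ {x y} → x ≃ y → abs x ≃ abs y
abs-cong {x} {y} (mk≃ x≃y) = mk≃ (NullSeq.small-dominated
  {g = λ k → ℚ.∣ seq x k ∣ ℚ.- ℚ.∣ seq y k ∣} {f = λ k → seq x k ℚ.- seq y k}
  (0 , λ k _ → ∣∣p∣-∣q∣∣≤∣p-q∣ (seq x k) (seq y k)) x≃y)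

abs-neg : ∀ x → abs (- x) ≃ abs x
abs-neg x = ≃-pointwise (λ k → ℚ.∣-p∣≡∣p∣ (seq x k))

-- From stage `M` on the sequence exceeds `δ`, so the difference of the two sides is exactly zero
-- there.
abs-positive : ∀ {x} → Positive x → abs x ≃ x
abs-positive {x} (δ , 0<δ , M , δ<x) = mk≃ (λ ε 0<ε → M , λ k M≤k →
  subst (λ q → ℚ.∣ q ∣ ℚ.< ε)
    (sym (trans (cong (ℚ._- seq x k) (ℚ.0≤p⇒∣p∣≡p (ℚ.<⇒≤ (ℚ.<-trans 0<δ (δ<x k M≤k)))))
      (ℚ.+-inverseʳ (seq x k))))
    0<ε)

abs-fixed : ∀ {x y} → abs y ≃ y → x ≃ y → abs x ≃ x
abs-fixed ∣y∣≃y x≃y = ≃-trans (abs-cong x≃y) (≃-trans ∣y∣≃y (≃-sym x≃y))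

abs-0 : abs 0ℝ ≃ 0ℝ
abs-0 = ≃-pointwise (λ _ → refl)

abs-1 : abs 1ℝ ≃ 1ℝ
abs-1 = ≃-pointwise (λ _ → refl)

-- Exchanging the vertices negates the determinant. This serves chords that wrap around, whose ends
-- have residues in the opposite order.
fareyDistance-sym : ∀ u v → fareyDistance u v ≃ fareyDistance v u
fareyDistance-sym u v = ≃-trans (abs-cong swap) (abs-neg _)
  where
  open FareyVertex
  swap : numerator u * denominator v - numerator v * denominator u
       ≃ - (numerator v * denominator u - numerator u * denominator v)
  swap = ≃-pointwise (λ k → ℚS.solve 4
    (λ a b c d → a ℚS.:* d ℚS.:- c ℚS.:* b ℚS.:= ℚS.:- (c ℚS.:* b ℚS.:- a ℚS.:* d)) refl
    (seq (numerator u) k) (seq (denominator u) k) (seq (numerator v) k) (seq (denominator v) k))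

-- Residues modulo the number of vertices.

-- The difference `r - s` is `(t - q) * N`, yet its absolute value is at most the larger of `r` and
-- `s`, hence below `N`; so `t - q` is zero.
remainder-unique : ∀ {N r s} (q t : ℤ) → r ℕ.< N → s ℕ.< N →
  + r ℤ.+ q ℤ.* + N ≡ + s ℤ.+ t ℤ.* + N → r ≡ s
remainder-unique {N} {r} {s} q t r<N s<N eq =
  ℤ.+-injective (ℤ.i-j≡0⇒i≡j (+ r) (+ s) (trans difference (cong (ℤ._* + N) t-q≡0)))
  where
  open ≡-Reasoning
  difference : + r ℤ.- + s ≡ (t ℤ.- q) ℤ.* + N
  difference = begin
    + r ℤ.- + s
      ≡⟨ ℤS.solve 4 (λ r s q M → r ℤS.:- s ℤS.:= (r ℤS.:+ q ℤS.:* M) ℤS.:- (s ℤS.:+ q ℤS.:* M))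
           refl (+ r) (+ s) q (+ N) ⟩
    (+ r ℤ.+ q ℤ.* + N) ℤ.- (+ s ℤ.+ q ℤ.* + N)
      ≡⟨ cong (ℤ._- (+ s ℤ.+ q ℤ.* + N)) eq ⟩
    (+ s ℤ.+ t ℤ.* + N) ℤ.- (+ s ℤ.+ q ℤ.* + N)
      ≡⟨ ℤS.solve 4 (λ s q t M → (s ℤS.:+ t ℤS.:* M) ℤS.:- (s ℤS.:+ q ℤS.:* M)
           ℤS.:= (t ℤS.:- q) ℤS.:* M) refl (+ s) q t (+ N) ⟩
    (t ℤ.- q) ℤ.* + N ∎
  ∣t-q∣*N<N : ℤ.∣ t ℤ.- q ∣ ℕ.* N ℕ.< 1 ℕ.* N
  ∣t-q∣*N<N = subst₂ ℕ._<_
    (trans (cong ℤ.∣_∣ (trans (sym (ℤ.m-n≡m⊖n r s)) difference)) (ℤ.abs-* (t ℤ.- q) (+ N)))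
    (sym (ℕ.*-identityˡ N))
    (ℕ.≤-<-trans (ℤ.∣m⊝n∣≤m⊔n r s) (ℕ.⊔-pres-<m r<N s<N))
  t-q≡0 : t ℤ.- q ≡ 0ℤ
  t-q≡0 = ℤ.∣i∣≡0⇒i≡0 (ℕ.n<1⇒n≡0 (ℕ.*-cancelʳ-< N ℤ.∣ t ℤ.- q ∣ 1 ∣t-q∣*N<N))

-- Since `a + d < 2N`, a step of length `d` from residue `a` wraps around at most once. If it does,
-- `b` is `a + d - N`, and the complementary step of length `N - d` leads from `b` back to `a`
-- without wrapping.
remainder-difference : ∀ {N a b d} (q t : ℤ) → a ℕ.< N → b ℕ.< N → d ℕ.≤ N →
  + a ℤ.+ q ℤ.* + N ℤ.+ + d ≡ + b ℤ.+ t ℤ.* + N → a ℕ.+ d ≡ b ⊎ b ℕ.+ (N ℕ.∸ d) ≡ a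
remainder-difference {N} {a} {b} {d} q t a<N b<N d≤N eq with a ℕ.+ d ℕ.<? N
... | yes a+d<N = inj₁ (remainder-unique q t a+d<N b<N (trans
  (ℤS.solve 3 (λ a d s → a ℤS.:+ d ℤS.:+ s ℤS.:= a ℤS.:+ s ℤS.:+ d) refl (+ a) (+ d) (q ℤ.* + N))
  eq))
... | no a+d≮N = inj₂ (trans
  (cong (ℕ._+ e) (remainder-unique t (1ℤ ℤ.+ q) b<N (ℕ.≤-<-trans (ℕ.m∸n≤m a e) a<N)
    (trans (sym eq) a+d≡c+N)))
  c+e≡a)
  where
  open ≡-Reasoning
  e = N ℕ.∸ d
  -- The subtraction is exact because `a + d ≥ N` gives `e ≤ a`; thus `c` is `a + d - N`.
  c = a ℕ.∸ e
  c+e≡a : c ℕ.+ e ≡ a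
  c+e≡a = ℕ.m∸n+n≡m (subst (e ℕ.≤_) (ℕ.m+n∸n≡m a d) (ℕ.∸-monoˡ-≤ d (ℕ.≮⇒≥ a+d≮N)))
  a+d≡c+N : + a ℤ.+ q ℤ.* + N ℤ.+ + d ≡ + c ℤ.+ (1ℤ ℤ.+ q) ℤ.* + N
  a+d≡c+N = begin
    + a ℤ.+ q ℤ.* + N ℤ.+ + d
      ≡⟨ cong (λ a → + a ℤ.+ q ℤ.* + N ℤ.+ + d) c+e≡a ⟨
    + (c ℕ.+ e) ℤ.+ q ℤ.* + N ℤ.+ + d
      ≡⟨ ℤS.solve 4 (λ c d e s → c ℤS.:+ e ℤS.:+ s ℤS.:+ d ℤS.:= c ℤS.:+ (d ℤS.:+ e) ℤS.:+ s)
           refl (+ c) (+ d) (+ e) (q ℤ.* + N) ⟩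
    + c ℤ.+ + (d ℕ.+ e) ℤ.+ q ℤ.* + N
      ≡⟨ cong (λ M → + c ℤ.+ + M ℤ.+ q ℤ.* + N) (ℕ.m+[n∸m]≡n d≤N) ⟩
    + c ℤ.+ + N ℤ.+ q ℤ.* + N
      ≡⟨ ℤS.solve 3 (λ c q M → c ℤS.:+ M ℤS.:+ q ℤS.:* M
           ℤS.:= c ℤS.:+ (ℤS.con 1ℤ ℤS.:+ q) ℤS.:* M) refl (+ c) q (+ N) ⟩
    + c ℤ.+ (1ℤ ℤ.+ q) ℤ.* + N ∎

residue-decomposition : ∀ {N} .{{_ : NonZero N}} x → x ≡ + toℕ (residue {N} x) ℤ.+ (x /ℕ N) ℤ.* + N
residue-decomposition {N} x = trans (a≡a%ℕn+[a/ℕn]*n x N)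
  (cong (λ r → + r ℤ.+ (x /ℕ N) ℤ.* + N) (sym (Fin.toℕ-fromℕ< (n%ℕd<d x N))))

-- Chords of the strip: boundary values and signs.

module _ {p n : ℕ} .{{_ : NonZero p}} (D : PAngulation p (3 ℕ.+ n))
         (m : ℤ → ℤ → ℝ) (F : IsFriezeOf D m) where
  open IsFrieze (proj₁ F)

  private
    N : ℕ
    N = 3 ℕ.+ n

    m-cong : ∀ {i i' j j'} → i ≡ i' → j ≡ j' → m i j ≃ m i' j'
    m-cong refl refl = ≃-refl

  -- ⟨x , x + d⟩ in the notation above; it lies in the strip when d ≤ N.
  chord : ℤ → ℕ → ℝ
  chord x d = m (x ℤ.+ 1ℤ) (x ℤ.+ + d ℤ.- 1ℤ)

  chord-congˡ : ∀ {x y} d → x ≡ y → chord x d ≃ chord y d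
  chord-congˡ d refl = ≃-refl

  chord-congʳ : ∀ x {d e} → d ≡ e → chord x d ≃ chord x e
  chord-congʳ x refl = ≃-refl

  chord-0 : ∀ x → chord x 0 ≃ 0ℝ
  chord-0 x = ≃-trans
    (m-cong refl (ℤS.solve 1 (λ x → x ℤS.:+ ℤS.con 0ℤ ℤS.:- ℤS.con 1ℤ
      ℤS.:= (x ℤS.:+ ℤS.con 1ℤ) ℤS.:- ℤS.con (+ 2)) refl x))
    (zeroˡ (x ℤ.+ 1ℤ))

  chord-1 : ∀ x → chord x 1 ≃ 1ℝ
  chord-1 x = oneˡ (x ℤ.+ 1ℤ)

  chord-N-1 : ∀ x → chord x (2 ℕ.+ n) ≃ 1ℝ
  chord-N-1 x = ≃-trans
    (m-cong refl (ℤS.solve 2 (λ x n → x ℤS.:+ (ℤS.con (+ 2) ℤS.:+ n) ℤS.:- ℤS.con 1ℤ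
      ℤS.:= x ℤS.:+ ℤS.con 1ℤ ℤS.:+ n) refl x (+ n)))
    (oneʳ (x ℤ.+ 1ℤ))

  chord-N : ∀ x → chord x N ≃ 0ℝ
  chord-N x = ≃-trans
    (m-cong refl (ℤS.solve 2 (λ x n → x ℤS.:+ (ℤS.con (+ 3) ℤS.:+ n) ℤS.:- ℤS.con 1ℤ
      ℤS.:= x ℤS.:+ ℤS.con 1ℤ ℤS.:+ n ℤS.:+ ℤS.con 1ℤ) refl x (+ n)))
    (zeroʳ (x ℤ.+ 1ℤ))

  -- Lengths `0` and `N` give 0, lengths `1` and `N - 1` give 1, and the lengths strictly between
  -- `1` and `N - 1` are the positive entries of the frieze.
  abs-chord : ∀ x d → d ℕ.≤ N → abs (chord x d) ≃ chord x d
  abs-chord x 0 _ = abs-fixed abs-0 (chord-0 x)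
  abs-chord x 1 _ = abs-fixed abs-1 (chord-1 x)
  abs-chord x (ℕ.suc (ℕ.suc r)) (ℕ.s≤s (ℕ.s≤s r≤1+n)) = cases (ℕ.<-cmp r n)
    where
    offset : (x ℤ.+ + (2 ℕ.+ r) ℤ.- 1ℤ) ℤ.- (x ℤ.+ 1ℤ) ≡ + r
    offset = ℤS.solve 2 (λ x r → (x ℤS.:+ (ℤS.con (+ 2) ℤS.:+ r) ℤS.:- ℤS.con 1ℤ)
      ℤS.:- (x ℤS.:+ ℤS.con 1ℤ) ℤS.:= r) refl x (+ r)
    cases : Tri (r ℕ.< n) (r ≡ n) (n ℕ.< r) → abs (chord x (2 ℕ.+ r)) ≃ chord x (2 ℕ.+ r)
    cases (tri< r<n _ _) = abs-positive (positive (x ℤ.+ 1ℤ) (x ℤ.+ + (2 ℕ.+ r) ℤ.- 1ℤ)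
      (subst (0ℤ ℤ.≤_) (sym offset) (ℤ.+≤+ ℕ.z≤n))
      (subst (ℤ._< + n) (sym offset) (ℤ.+<+ r<n)))
    cases (tri≈ _ r≡n _) = abs-fixed abs-1
      (≃-trans (chord-congʳ x (cong (2 ℕ.+_) r≡n)) (chord-N-1 x))
    cases (tri> _ _ n<r) = abs-fixed abs-0
      (≃-trans (chord-congʳ x (cong (2 ℕ.+_) (ℕ.≤-antisym r≤1+n n<r))) (chord-N x))

  -- The Ptolemy relation.

  chord-recurrence : ∀ b r → r ℕ.≤ 1 ℕ.+ n →
    chord b (2 ℕ.+ r) ≃ chord b 2 * chord (b ℤ.+ 1ℤ) (1 ℕ.+ r) - chord (b ℤ.+ 1ℤ ℤ.+ 1ℤ) r
  chord-recurrence b r r≤ = begin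
    chord b (2 ℕ.+ r)
      ≈⟨ m-cong refl (ℤS.solve 2 (λ b r → b ℤS.:+ (ℤS.con (+ 2) ℤS.:+ r) ℤS.:- ℤS.con 1ℤ
           ℤS.:= b ℤS.:+ ℤS.con 1ℤ ℤS.:+ r) refl b (+ r)) ⟩
    m i (i ℤ.+ + r)
      ≈⟨ frieze-recurrence D m F r i r≤ ⟩
    m i i * m (i ℤ.+ 1ℤ) (i ℤ.+ + r) - m (i ℤ.+ + 2) (i ℤ.+ + r)
      ≈⟨ R.+-cong
           (R.*-cong
             (m-cong refl (ℤS.solve 1 (λ b → b ℤS.:+ ℤS.con 1ℤ
               ℤS.:= b ℤS.:+ ℤS.con (+ 2) ℤS.:- ℤS.con 1ℤ) refl b))
             (m-cong refl (ℤS.solve 2 (λ i r → i ℤS.:+ r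
               ℤS.:= i ℤS.:+ (ℤS.con 1ℤ ℤS.:+ r) ℤS.:- ℤS.con 1ℤ) refl i (+ r))))
           (R.-‿cong (m-cong
             (ℤS.solve 1 (λ i → i ℤS.:+ ℤS.con (+ 2)
               ℤS.:= i ℤS.:+ ℤS.con 1ℤ ℤS.:+ ℤS.con 1ℤ) refl i)
             (ℤS.solve 2 (λ i r → i ℤS.:+ r
               ℤS.:= i ℤS.:+ ℤS.con 1ℤ ℤS.:+ r ℤS.:- ℤS.con 1ℤ) refl i (+ r)))) ⟩
    chord b 2 * chord i (1 ℕ.+ r) - chord (i ℤ.+ 1ℤ) r ∎
    where
    open ≈-Reasoning R.setoid
    i = b ℤ.+ 1ℤ

  -- Ptolemy's relation for the vertices `b`, `b + 1`, `b + 1 + k` and `b + 1 + k + t`, where the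
  -- side from `b` to `b + 1` has value 1 and drops out. The induction on `k` uses the hypothesis at
  -- base `b + 1` and returns to base `b` by the recurrence.
  ptolemy : ∀ k t b → k ℕ.+ t ℕ.≤ 2 ℕ.+ n →
    chord (b ℤ.+ 1ℤ ℤ.+ + k) t
      ≃ chord b (1 ℕ.+ k) * chord (b ℤ.+ 1ℤ) (k ℕ.+ t)
        - chord b (1 ℕ.+ (k ℕ.+ t)) * chord (b ℤ.+ 1ℤ) k
  ptolemy ℕ.zero t b _ = begin
    chord (b ℤ.+ 1ℤ ℤ.+ 0ℤ) t
      ≈⟨ chord-congˡ t (ℤ.+-identityʳ (b ℤ.+ 1ℤ)) ⟩
    chord (b ℤ.+ 1ℤ) t
      ≈⟨ ≃-pointwise (λ k → ℚS.solve 2 (λ x y → x ℚS.:= ℚS.con 1ℚ ℚS.:* x ℚS.:- y ℚS.:* ℚS.con 0ℚ)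
           refl (seq (chord (b ℤ.+ 1ℤ) t) k) (seq (chord b (1 ℕ.+ t)) k)) ⟩
    1ℝ * chord (b ℤ.+ 1ℤ) t - chord b (1 ℕ.+ t) * 0ℝ
      ≈⟨ R.+-cong (R.*-congʳ (chord-1 b)) (R.-‿cong (R.*-congˡ (chord-0 (b ℤ.+ 1ℤ)))) ⟨
    chord b 1 * chord (b ℤ.+ 1ℤ) t - chord b (1 ℕ.+ t) * chord (b ℤ.+ 1ℤ) 0 ∎
    where open ≈-Reasoning R.setoid
  ptolemy (ℕ.suc k) t b (ℕ.s≤s k+t≤) = begin
    chord (i ℤ.+ + (1 ℕ.+ k)) t
      ≈⟨ chord-congˡ t (sym (ℤ.+-assoc i 1ℤ (+ k))) ⟩
    chord (i ℤ.+ 1ℤ ℤ.+ + k) t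
      ≈⟨ ptolemy k t i (ℕ.m≤n⇒m≤1+n k+t≤) ⟩
    A * B' - B * A'
      -- The map `(A, A') ↦ (c * A - A', A)`, applied alike to `(B, B')`, has determinant 1, so the
      -- 2-by-2 determinant is preserved.
      ≈⟨ ≃-pointwise (λ k → ℚS.solve 5 (λ c A A' B B' → A ℚS.:* B' ℚS.:- B ℚS.:* A'
           ℚS.:= (c ℚS.:* A ℚS.:- A') ℚS.:* B ℚS.:- (c ℚS.:* B ℚS.:- B') ℚS.:* A) refl
           (seq c k) (seq A k) (seq A' k) (seq B k) (seq B' k)) ⟩
    (c * A - A') * B - (c * B - B') * A
      ≈⟨ R.+-cong (R.*-congʳ (chord-recurrence b k (ℕ.m+n≤o⇒m≤o k k+t≤)))
           (R.-‿cong (R.*-congʳ (chord-recurrence b (k ℕ.+ t) k+t≤))) ⟨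
    chord b (2 ℕ.+ k) * B - chord b (2 ℕ.+ (k ℕ.+ t)) * A ∎
    where
    open ≈-Reasoning R.setoid
    i = b ℤ.+ 1ℤ
    c = chord b 2
    A = chord i (1 ℕ.+ k)
    A' = chord (i ℤ.+ 1ℤ) k
    B = chord i (1 ℕ.+ (k ℕ.+ t))
    B' = chord (i ℤ.+ 1ℤ) (k ℕ.+ t)

  -- Glide symmetry and periodicity.

  -- In Ptolemy's relation with last vertex `x + N`, the chord from `x` to `x + N` is 0 and the one
  -- from `x + 1` to `x + N` is 1, so only the chord of length `d` survives. Length 0 is treated
  -- apart, as the relation needs `d` to be at least 1.
  glide : ∀ x d e → d ℕ.+ e ≡ N → chord (x ℤ.+ + d) e ≃ chord x d
  glide x ℕ.zero e refl = begin
    chord (x ℤ.+ 0ℤ) N   ≈⟨ chord-N (x ℤ.+ 0ℤ) ⟩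
    0ℝ                   ≈⟨ chord-0 x ⟨
    chord x 0            ∎
    where open ≈-Reasoning R.setoid
  glide x (ℕ.suc k) e eq = begin
    chord (x ℤ.+ + (1 ℕ.+ k)) e
      ≈⟨ chord-congˡ e (sym (ℤ.+-assoc x 1ℤ (+ k))) ⟩
    chord (x ℤ.+ 1ℤ ℤ.+ + k) e
      ≈⟨ ptolemy k e x (ℕ.≤-reflexive k+e≡) ⟩
    chord x (1 ℕ.+ k) * chord (x ℤ.+ 1ℤ) (k ℕ.+ e) - chord x (1 ℕ.+ (k ℕ.+ e)) * chord (x ℤ.+ 1ℤ) k
      ≈⟨ R.+-cong
           (R.*-congˡ (≃-trans (chord-congʳ (x ℤ.+ 1ℤ) k+e≡) (chord-N-1 (x ℤ.+ 1ℤ))))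
           (R.-‿cong (R.*-congʳ (≃-trans (chord-congʳ x eq) (chord-N x)))) ⟩
    chord x (1 ℕ.+ k) * 1ℝ - 0ℝ * chord (x ℤ.+ 1ℤ) k
      ≈⟨ ≃-pointwise (λ j → ℚS.solve 2 (λ x y → x ℚS.:* ℚS.con 1ℚ ℚS.:- ℚS.con 0ℚ ℚS.:* y ℚS.:= x)
           refl (seq (chord x (1 ℕ.+ k)) j) (seq (chord (x ℤ.+ 1ℤ) k) j)) ⟩
    chord x (1 ℕ.+ k) ∎
    where
    open ≈-Reasoning R.setoid
    k+e≡ : k ℕ.+ e ≡ 2 ℕ.+ n
    k+e≡ = ℕ.suc-injective eq

  -- Two glides, over the complementary lengths `d` and `N - d`, add up to a shift by `N`.
  chord-period : ∀ x d → d ℕ.≤ N → chord (x ℤ.+ + N) d ≃ chord x d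
  chord-period x d d≤N = begin
    chord (x ℤ.+ + N) d          ≈⟨ chord-congˡ d shift ⟩
    chord (x ℤ.+ + d ℤ.+ + e) d  ≈⟨ glide (x ℤ.+ + d) e d (ℕ.m∸n+n≡m d≤N) ⟩
    chord (x ℤ.+ + d) e          ≈⟨ glide x d e (ℕ.m+[n∸m]≡n d≤N) ⟩
    chord x d                    ∎
    where
    open ≈-Reasoning R.setoid
    e = N ℕ.∸ d
    shift : x ℤ.+ + N ≡ x ℤ.+ + d ℤ.+ + e
    shift = trans (cong (λ M → x ℤ.+ + M) (sym (ℕ.m+[n∸m]≡n d≤N))) (sym (ℤ.+-assoc x (+ d) (+ e)))

  chord-periods⁺ : ∀ q x d → d ℕ.≤ N → chord (x ℤ.+ + q ℤ.* + N) d ≃ chord x d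
  chord-periods⁺ ℕ.zero    x d _   = chord-congˡ d (ℤ.+-identityʳ x)
  chord-periods⁺ (ℕ.suc q) x d d≤N = ≃-trans
    (chord-congˡ d (ℤS.solve 3 (λ x q M → x ℤS.:+ (ℤS.con 1ℤ ℤS.:+ q) ℤS.:* M
      ℤS.:= x ℤS.:+ q ℤS.:* M ℤS.:+ M) refl x (+ q) (+ N)))
    (≃-trans (chord-period (x ℤ.+ + q ℤ.* + N) d d≤N) (chord-periods⁺ q x d d≤N))

  chord-periods : ∀ q x d → d ℕ.≤ N → chord (x ℤ.+ q ℤ.* + N) d ≃ chord x d
  chord-periods (+ q)    x d d≤N = chord-periods⁺ q x d d≤N
  chord-periods -[1+ q ] x d d≤N = ≃-trans
    -- Shifting the displaced chord forward by the same multiple of `N` returns to `x`.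
    (≃-sym (chord-periods⁺ (ℕ.suc q) (x ℤ.+ -[1+ q ] ℤ.* + N) d d≤N))
    (chord-congˡ d (ℤS.solve 3 (λ x q M → x ℤS.:+ (ℤS.:- q) ℤS.:* M ℤS.:+ q ℤS.:* M ℤS.:= x)
      refl x (+ ℕ.suc q) (+ N)))

  -- Chords as Farey distances.

  -- Take base `-1` in Ptolemy's relation: `chord -1ℤ (1 + a)` and `chord 0ℤ a` unfold to the
  -- numerator and denominator of the vertex `α`, and likewise for `β`.
  chord-fareyDistance : ∀ (α β : Fin N) d → toℕ α ℕ.+ d ≡ toℕ β →
    chord (+ toℕ α) d ≃ fareyDistance (fareyVertex D m F α) (fareyVertex D m F β)
  chord-fareyDistance α β d α+d≡β = begin
    chord (+ a) d
      ≈⟨ abs-chord (+ a) d (ℕ.<⇒≤ (ℕ.m+n≤o⇒n≤o a (subst (ℕ._≤ N) (sym (ℕ.+-suc a d)) a+d<N))) ⟨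
    abs (chord (+ a) d)
      ≈⟨ abs-cong (ptolemy a d -1ℤ (ℕ.≤-pred a+d<N)) ⟩
    abs (chord -1ℤ (1 ℕ.+ a) * chord 0ℤ (a ℕ.+ d) - chord -1ℤ (1 ℕ.+ (a ℕ.+ d)) * chord 0ℤ a)
      ≈⟨ abs-cong (R.+-cong
           (R.*-congˡ (chord-congʳ 0ℤ α+d≡β))
           (R.-‿cong (R.*-congʳ (chord-congʳ -1ℤ (cong ℕ.suc α+d≡β))))) ⟩
    fareyDistance (fareyVertex D m F α) (fareyVertex D m F β) ∎
    where
    open ≈-Reasoning R.setoid
    a = toℕ α
    a+d<N : a ℕ.+ d ℕ.< N
    a+d<N = subst (ℕ._< N) (sym α+d≡β) (Fin.toℕ<n β)

  -- If the residues of the ends are in order, periodicity moves the chord to them. If it wraps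
  -- around, the glide first replaces it by the complementary chord from `y`, which exchanges the
  -- two vertices.
  chord≃fareyDistance : ∀ x y d → d ℕ.≤ N → x ℤ.+ + d ≡ y →
    chord x d ≃ fareyDistance (fareyVertex D m F (residue x)) (fareyVertex D m F (residue y))
  chord≃fareyDistance x y d d≤N x+d≡y = [ unwrapped , wrapped ]′
    (remainder-difference q t (Fin.toℕ<n α) (Fin.toℕ<n β) d≤N
      (trans (cong (ℤ._+ + d) (sym x≡)) (trans x+d≡y y≡)))
    where
    open ≈-Reasoning R.setoid
    e : ℕ
    e = N ℕ.∸ d
    q t : ℤ
    q = x /ℕ N
    t = y /ℕ N
    α β : Fin N
    α = residue x
    β = residue y
    x≡ : x ≡ + toℕ α ℤ.+ q ℤ.* + N
    x≡ = residue-decomposition x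
    y≡ : y ≡ + toℕ β ℤ.+ t ℤ.* + N
    y≡ = residue-decomposition y
    u v : FareyVertex
    u = fareyVertex D m F α
    v = fareyVertex D m F β
    unwrapped : toℕ α ℕ.+ d ≡ toℕ β → chord x d ≃ fareyDistance u v
    unwrapped α+d≡β = begin
      chord x d                         ≈⟨ chord-congˡ d x≡ ⟩
      chord (+ toℕ α ℤ.+ q ℤ.* + N) d   ≈⟨ chord-periods q (+ toℕ α) d d≤N ⟩
      chord (+ toℕ α) d                 ≈⟨ chord-fareyDistance α β d α+d≡β ⟩
      fareyDistance u v                 ∎
    wrapped : toℕ β ℕ.+ e ≡ toℕ α → chord x d ≃ fareyDistance u v
    wrapped β+e≡α = begin
      chord x d                         ≈⟨ glide x d e (ℕ.m+[n∸m]≡n d≤N) ⟨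
      chord (x ℤ.+ + d) e               ≈⟨ chord-congˡ e (trans x+d≡y y≡) ⟩
      chord (+ toℕ β ℤ.+ t ℤ.* + N) e   ≈⟨ chord-periods t (+ toℕ β) e (ℕ.m∸n≤m N d) ⟩
      chord (+ toℕ β) e                 ≈⟨ chord-fareyDistance β α e β+e≡α ⟩
      fareyDistance v u                 ≈⟨ fareyDistance-sym v u ⟩
      fareyDistance u v                 ∎

proposition18 : (p n : ℕ) .{{_ : NonZero p}} → 3 ℕ.≤ p →
    (D : PAngulation p (3 ℕ.+ n)) (m : ℤ → ℤ → ℝ) (F : IsFriezeOf D m) →
    let v : ℤ → FareyVertex
        v i = fareyVertex D m F (residue i)
    in ∀ i j → ℤ.- + 2 ℤ.≤ j ℤ.- i → j ℤ.- i ℤ.≤ + n ℤ.+ 1ℤ →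
       m i j ≃ fareyDistance (v (i ℤ.- 1ℤ)) (v (j ℤ.+ 1ℤ))
proposition18 p n _ D m F i j -2≤j-i j-i≤n+1 = ≃-trans
  (R.reflexive (cong₂ m i≡ j≡))
  (chord≃fareyDistance D m F (i ℤ.- 1ℤ) (j ℤ.+ 1ℤ) d d≤N x+d≡y)
  where
  d : ℕ
  -- The entry `m i j` is the chord from `i - 1` to `j + 1`, of length `j - i + 2`. The lower bound
  -- on `j - i` makes this nonnegative, so the absolute value only turns it into a natural number.
  d = ℤ.∣ j ℤ.- i ℤ.+ + 2 ∣
  +d≡ : + d ≡ j ℤ.- i ℤ.+ + 2
  +d≡ = ℤ.0≤i⇒+∣i∣≡i (ℤ.+-monoˡ-≤ (+ 2) -2≤j-i)
  d≤N : d ℕ.≤ 3 ℕ.+ n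
  d≤N = ℤ.drop‿+≤+ (subst₂ ℤ._≤_ (sym +d≡)
    (ℤS.solve 1 (λ n → n ℤS.:+ ℤS.con 1ℤ ℤS.:+ ℤS.con (+ 2) ℤS.:= ℤS.con (+ 3) ℤS.:+ n) refl (+ n))
    (ℤ.+-monoˡ-≤ (+ 2) j-i≤n+1))
  x+d≡y : i ℤ.- 1ℤ ℤ.+ + d ≡ j ℤ.+ 1ℤ
  x+d≡y = trans (cong (λ k → i ℤ.- 1ℤ ℤ.+ k) +d≡)
    (ℤS.solve 2 (λ i j → i ℤS.:- ℤS.con 1ℤ ℤS.:+ (j ℤS.:- i ℤS.:+ ℤS.con (+ 2))
      ℤS.:= j ℤS.:+ ℤS.con 1ℤ) refl i j)
  i≡ : i ≡ i ℤ.- 1ℤ ℤ.+ 1ℤ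
  i≡ = ℤS.solve 1 (λ i → i ℤS.:= i ℤS.:- ℤS.con 1ℤ ℤS.:+ ℤS.con 1ℤ) refl i
  j≡ : j ≡ i ℤ.- 1ℤ ℤ.+ + d ℤ.- 1ℤ
  j≡ = trans (ℤS.solve 1 (λ j → j ℤS.:= j ℤS.:+ ℤS.con 1ℤ ℤS.:- ℤS.con 1ℤ) refl j)
    (cong (ℤ._- 1ℤ) (sym x+d≡y))
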